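{- Let $\lambda_1,\lambda_2\in[0,1]$. If $G_1$ is an $(N_1,D_1,\lambda_1)$-graph on $[N_1]$ and $G_2$ is a $(D_1,D_2,\lambda_2)$-graph on $[D_1]$, then their zig-zag product is an $(N_1\cdot D_1,\,D_2^2,\,f(\lambda_1,\lambda_2))$-graph, where $$f(\lambda_1,\lambda_2)=\frac12(1-\lambda_2^2)\lambda_1+\frac12\sqrt{(1-\lambda_2^2)^2\lambda_1^2+4\lambda_2^2}.$$
   Context: For a positive integer $n$, $[n]=\{1,\dots,n\}$. Graphs are finite, undirected and regular, and may have self-loops and parallel edges. A $D$-regular graph $G$ on $[N]$ is specified by its rotation map $\mathrm{Rot}_G:[N]\times[D]\to[N]\times[D]$: $\mathrm{Rot}_G(v,i)=(w,j)$ means that the $i$-th edge incident to $v$ leads to $w$ and that this edge is the $j$-th edge incident to $w$. Thus $\mathrm{Rot}_G$ is a permutation with $\mathrm{Rot}_G\circ\mathrm{Rot}_G=\mathrm{id}$ (and any such involution specifies a $D$-regular graph). Vertex sets and sets of edge labels may be any finite sets of the right cardinality. The normalized adjacency matrix of $G$ is the symmetric $N\times N$ matrix with $M_{u,v}=\frac1D|\{(i,j)\in[D]^2:\mathrm{Rot}_G(u,i)=(v,j)\}|$. The second largest eigenvalue in absolute value is $\lambda(G)=\max_{\alpha\perp 1_N,\,\alpha\ne0}\|M\alpha\|/\|\alpha\|$, where $1_N$ is the all-ones vector and the norm is Euclidean (with $\lambda(G)=0$ if $N=1$). An $(N,D,\lambda)$-graph is a $D$-regular graph on $N$ vertices with $\lambda(G)\le\lambda$.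 Zig-zag product: for a $D_1$-regular graph $G_1$ on $[N_1]$ and a $D_2$-regular graph $G_2$ on $[D_1]$, it is the $D_2^2$-regular graph on $[N_1]\times[D_1]$, with edge labels in $[D_2]\times[D_2]$, whose rotation map sends $((v,k),(i,j))$ to $((w,\ell),(j',i'))$, where $(k',i')=\mathrm{Rot}_{G_2}(k,i)$, then $(w,\ell')=\mathrm{Rot}_{G_1}(v,k')$, then $(\ell,j')=\mathrm{Rot}_{G_2}(\ell',j)$. -}

module Defs where

open import Algebra.Bundles using (CommutativeRing)
open import Algebra.Structures using (IsCommutativeRing)
open import Data.Fin.Base using (Fin)
open import Data.Fin.Properties as Fin using ()
open import Data.List.Base using (allFin; cartesianProduct; filter; length)
open import Data.Nat.Base using (ℕ)
open import Data.Product.Base using (_×_; _,_; proj₁; proj₂; ∃)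
open import Data.Product.Properties using (≡-dec)
open import Data.Vec.Functional using (Vector)
open import Function.Bundles using (_↔_; module Inverse)
open import Level using (0ℓ)
open import Relation.Binary.Core using (Rel)
open import Relation.Binary.Structures using (IsDecTotalOrder)
open import Relation.Binary.PropositionalEquality
  using (_≡_; refl; cong; module ≡-Reasoning)
open import Relation.Nullary.Negation using (¬_)

-- The classical axioms of a Dedekind-complete ordered field, which
-- determine ℝ up to isomorphism.  Decidability of the order expresses the
-- classical reading of ℝ.  As is common, inverses and suprema are total
-- functions, constrained only where the inverse or supremum exists.
record RealNumbers : Set₁ where
  infixl 7 _*_ _/_
  infixl 6 _+_
  infix  8 -_ _⁻¹
  infix  4 _≈_ _≤_
  field
    Carrier           : Set
    _≈_               : Rel Carrier 0ℓ
    _+_ _*_           : Carrier → Carrier → Carrier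
    -_                : Carrier → Carrier
    0# 1#             : Carrier
    isCommutativeRing : IsCommutativeRing _≈_ _+_ _*_ -_ 0# 1#

    0≉1               : ¬ (0# ≈ 1#)
    _⁻¹               : Carrier → Carrier
    *-inverseʳ        : ∀ x → ¬ (x ≈ 0#) → x * x ⁻¹ ≈ 1#

    _≤_               : Rel Carrier 0ℓ
    isDecTotalOrder   : IsDecTotalOrder _≈_ _≤_
    +-monoˡ-≤         : ∀ z {x y} → x ≤ y → x + z ≤ y + z
    *-nonNeg          : ∀ {x y} → 0# ≤ x → 0# ≤ y → 0# ≤ x * y

  IsUpperBound : (Carrier → Set) → Carrier → Set
  IsUpperBound P b = ∀ x → P x → x ≤ b

  IsLeastUpperBound : (Carrier → Set) → Carrier → Set
  IsLeastUpperBound P s = IsUpperBound P s × (∀ b → IsUpperBound P b → s ≤ b)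

  field
    sup               : (Carrier → Set) → Carrier
    sup-isLUB         : ∀ P → ∃ P → ∃ (IsUpperBound P) →
                        IsLeastUpperBound P (sup P)

  commutativeRing : CommutativeRing 0ℓ 0ℓ
  commutativeRing = record { isCommutativeRing = isCommutativeRing }

  open CommutativeRing commutativeRing public
    using (_-_; +-commutativeMonoid; +-rawMonoid)

  open import Algebra.Properties.CommutativeMonoid.Sum +-commutativeMonoid public
    using (sum)
  open import Algebra.Definitions.RawMonoid +-rawMonoid
    using () renaming (_×_ to _·_)

  _/_ : Carrier → Carrier → Carrier
  x / y = x * y ⁻¹

  fromℕ : ℕ → Carrier
  fromℕ n = n · 1#

  infixr 9 _²
  _² : Carrier → Carrier
  x ² = x * x

  -- For 0# ≤ x this is the nonnegative square root of x.
  √_ : Carrier → Carrier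
  √ x = sup (λ y → y ² ≤ x)

-- A regular graph with vertex set V and edge labels E, given by its rotation
-- map; self-loops and parallel edges are allowed.
record Graph (V E : Set) : Set where
  field
    rot            : V × E → V × E
    rot-involutive : ∀ p → rot (rot p) ≡ p

open Graph public

relabel : ∀ {V E : Set} {N D} → Fin N ↔ V → Fin D ↔ E →
          Graph V E → Graph (Fin N) (Fin D)
relabel {V} {E} {N} {D} ν ε G = record
  { rot            = λ p → back (rot G (forth p))
  ; rot-involutive = λ p → begin
      back (rot G (forth (back (rot G (forth p)))))
        ≡⟨ cong (λ q → back (rot G q)) (forth-back (rot G (forth p))) ⟩
      back (rot G (rot G (forth p)))
        ≡⟨ cong back (rot-involutive G (forth p)) ⟩
      back (forth p)
        ≡⟨ back-forth p ⟩
      p ∎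
  }
  where
  open ≡-Reasoning
  module ν = Inverse ν
  module ε = Inverse ε

  forth : Fin N × Fin D → V × E
  forth (v , i) = ν.to v , ε.to i

  back : V × E → Fin N × Fin D
  back (v , i) = ν.from v , ε.from i

  forth-back : ∀ q → forth (back q) ≡ q
  forth-back (v , i)
    rewrite ν.strictlyInverseˡ v | ε.strictlyInverseˡ i = refl

  back-forth : ∀ p → back (forth p) ≡ p
  back-forth (v , i)
    rewrite ν.strictlyInverseʳ v | ε.strictlyInverseʳ i = refl

-- Note the reversed order (j′ , i′) of the returned labels, which makes the
-- map an involution.
zigzag : ∀ {V₁ E₁ E₂ : Set} → Graph V₁ E₁ → Graph E₁ E₂ →
         Graph (V₁ × E₁) (E₂ × E₂)
zigzag {V₁} {E₁} {E₂} G₁ G₂ = record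
  { rot = zz ; rot-involutive = zz-involutive }
  where
  zz : (V₁ × E₁) × (E₂ × E₂) → (V₁ × E₁) × (E₂ × E₂)
  zz ((v , k) , (i , j)) =
    let (k′ , i′) = rot G₂ (k , i)
        (w , ℓ′)  = rot G₁ (v , k′)
        (ℓ , j′)  = rot G₂ (ℓ′ , j)
    in (w , ℓ) , (j′ , i′)

  zz-involutive : ∀ p → zz (zz p) ≡ p
  zz-involutive ((v , k) , (i , j))
    rewrite rot-involutive G₂ (proj₂ (rot G₁ (v , proj₁ (rot G₂ (k , i)))) , j)
          | rot-involutive G₁ (v , proj₁ (rot G₂ (k , i)))
          | rot-involutive G₂ (k , i)
          = refl

multiplicity : ∀ {N D} → Graph (Fin N) (Fin D) → Fin N → Fin N → ℕ
multiplicity {N} {D} G u v =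
  length (filter (λ (i , j) → ≡-dec Fin._≟_ Fin._≟_ (rot G (u , i)) (v , j))
                 (cartesianProduct (allFin D) (allFin D)))

module Spectral (ℝ : RealNumbers) where
  open RealNumbers ℝ public

  ⟨_,_⟩ : ∀ {n} → Vector Carrier n → Vector Carrier n → Carrier
  ⟨ α , β ⟩ = sum (λ v → α v * β v)

  ‖_‖ : ∀ {n} → Vector Carrier n → Carrier
  ‖ α ‖ = √ ⟨ α , α ⟩

  adjacency : ∀ {N D} → Graph (Fin N) (Fin D) → Fin N → Fin N → Carrier
  adjacency {D = D} G u v = fromℕ (multiplicity G u v) / fromℕ D

  infixr 8 _$ᵥ_
  _$ᵥ_ : ∀ {m n} → (Fin m → Fin n → Carrier) →
         Vector Carrier n → Vector Carrier m
  (M $ᵥ α) u = sum (λ v → M u v * α v)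

  𝟏 : ∀ {n} → Vector Carrier n
  𝟏 _ = 1#

  IsZero : ∀ {n} → Vector Carrier n → Set
  IsZero α = ∀ v → α v ≈ 0#

  StretchFactor : ∀ {N D} → Graph (Fin N) (Fin D) → Carrier → Set
  StretchFactor {N} G r = ∃ λ (α : Vector Carrier N) →
    ⟨ α , 𝟏 ⟩ ≈ 0# × ¬ IsZero α × r ≈ ‖ adjacency G $ᵥ α ‖ / ‖ α ‖

  -- For N ≥ 2 the stretch factors attain their supremum (by compactness of
  -- the unit sphere), so the supremum is their maximum.
  secondEigenvalue : ∀ {N D} → Graph (Fin N) (Fin D) → Carrier
  secondEigenvalue {1} G = 0#
  secondEigenvalue     G = sup (StretchFactor G)

  -- G is an (N , D , μ)-graph.
  IsSpectralGraph : ∀ N D → Carrier → Graph (Fin N) (Fin D) → Set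
  IsSpectralGraph N D μ G = secondEigenvalue G ≤ μ

  zigzagBound : Carrier → Carrier → Carrier
  zigzagBound λ₁ λ₂ =
      ½ * (1# - λ₂ ²) * λ₁
    + ½ * √ ((1# - λ₂ ²) ² * λ₁ ² + fromℕ 4 * λ₂ ²)
    where
    ½ : Carrier
    ½ = 1# / fromℕ 2

{-# OPTIONS --safe #-}
module Submission where

-- Write M for the normalized adjacency operator of the zig-zag product: it is
-- B A B, where B averages inside each cloud along G₂ and A is the permutation
-- of coordinates given by the rotation map of G₁, hence a symmetric isometry.
-- If b ⊥ 𝟏 has cloud averages x and z = b − x, then B b = x + y with y = B z,
-- x ⊥ y, ‖y‖ ≤ λ₂ ‖z‖ and |⟪ A x , x ⟫| ≤ λ₁ ‖x‖².  These relations alone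
-- give |⟪ M b , b ⟫| = |⟪ A (x + y) , x + y ⟫| ≤ f (‖x‖² + ‖z‖²) = f ‖b‖²: with
-- L = λ₂², f is the nonnegative root of f² = (1 − L) λ₁ f + L, and the slack is
-- a nonnegative combination of squares (see Certificate).  Polarization turns
-- the bound on the quadratic form into one on ‖M b‖, so no eigenvectors are
-- needed.

open import Defs
open import Algebra.Bundles using (CommutativeRing)
open import Data.Bool.Base using (true; false; if_then_else_)
open import Data.Fin.Base using (Fin; zero; suc; combine; remQuot; _↑ˡ_; _↑ʳ_; punchIn)
import Data.Fin.Properties as Fin
open import Data.Fin.Permutation using (permutation)
open import Data.Fin.Properties using (*↔×)
open import Data.Integer.Base as ℤ using (ℤ; +_; -[1+_]; _⊖_)
import Data.Integer.Properties as ℤ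
open import Data.List.Base as List using (_++_; length; filter; tabulate; cartesianProduct)
import Data.List.Properties as List
open import Data.Maybe.Base as Maybe using (Maybe)
open import Data.Nat.Base as ℕ using (ℕ; zero; suc; NonZero)
  renaming (_*_ to _*ℕ_; _+_ to _+ℕ_)
import Data.Nat.Properties as ℕ
open import Data.Product.Base using (_×_; _,_; proj₁; proj₂; ∃; uncurry)
open import Data.Product.Properties using (≡-dec)
open import Data.Sum.Base using (_⊎_; inj₁; inj₂)
open import Data.Vec.Functional using (Vector)
open import Function.Base using (_∘_; id)
import Relation.Binary.Reasoning.Setoid as SetoidReasoning
open import Relation.Binary.PropositionalEquality as ≡ using (_≡_)
open import Relation.Binary.Structures using (IsDecTotalOrder)
open import Relation.Nullary using (¬_; Dec; yes; no; does; contradiction)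
open import Relation.Nullary.Decidable using (dec⇒maybe)
open import Relation.Unary using (Decidable)

-- The equation for f is forced. Fix x with ⟪ A x , x ⟫ = λ₁ ‖x‖² and put w = A x - λ₁ x, which is
-- orthogonal to x with ‖w‖² = (1 - λ₁²) ‖x‖². Over y ⊥ x, the expression L ⟪ A (x + y) , x + y ⟫ -
-- f ‖y‖² is stationary at y = L w / (f + λ₁ L), and asking that its value there be f L ‖x‖² is
-- exactly f² = (1 - L) λ₁ f + L. The certificate completes the square around this y, multiplied by
-- the square of the denominator so that nothing is divided. A second constraint is that
-- `secondEigenvalue` is a supremum of quotients of square roots, and `sup` is specified only for
-- nonempty bounded sets. Bounds are therefore carried as root-free inequalities between inner
-- products and converted only at the two ends. The conversion needs the a priori bound 1 and a
-- nonzero vector orthogonal to 𝟏, which exists from two vertices on.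

-- Ring normalization with integer coefficients.

module IntegerCoefficients {c ℓ} (R : CommutativeRing c ℓ) where
  open CommutativeRing R
  open import Algebra.Properties.Ring ring
    using (-‿distribˡ-*; -‿distribʳ-*; -0#≈0#; -‿involutive; -‿+-comm)
  open import Algebra.Properties.Semiring.Mult semiring
    using (×-homo-+; ×1-homo-*) renaming (_×_ to _·_)
  open import Algebra.Solver.Ring.AlmostCommutativeRing
    using (AlmostCommutativeRing; fromCommutativeRing; _-Raw-AlmostCommutative⟶_)
  open SetoidReasoning setoid

  ⟦_⟧ℤ : ℤ → Carrier
  ⟦ + n      ⟧ℤ = n · 1#
  ⟦ -[1+ n ] ⟧ℤ = - (suc n · 1#)

  cancel-+ˡ : ∀ x y z → (x + y) + - (x + z) ≈ y + - z
  cancel-+ˡ x y z = begin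
    (x + y) + - (x + z)     ≈⟨ +-cong (+-comm y x) (-‿+-comm x z) ⟨
    (y + x) + (- x + - z)   ≈⟨ +-assoc y x _ ⟩
    y + (x + (- x + - z))   ≈⟨ +-congˡ (+-assoc x _ _) ⟨
    y + ((x + - x) + - z)   ≈⟨ +-congˡ (+-congʳ (-‿inverseʳ x)) ⟩
    y + (0# + - z)          ≈⟨ +-congˡ (+-identityˡ _) ⟩
    y + - z                 ∎

  ⟦⟧-⊖ : ∀ m n → ⟦ m ⊖ n ⟧ℤ ≈ m · 1# + - (n · 1#)
  ⟦⟧-⊖ m zero = sym (trans (+-congˡ -0#≈0#) (+-identityʳ _))
  ⟦⟧-⊖ zero (suc n) = sym (+-identityˡ _)
  ⟦⟧-⊖ (suc m) (suc n) = begin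
    ⟦ suc m ⊖ suc n ⟧ℤ                 ≡⟨ ≡.cong ⟦_⟧ℤ (ℤ.[1+m]⊖[1+n]≡m⊖n m n) ⟩
    ⟦ m ⊖ n ⟧ℤ                         ≈⟨ ⟦⟧-⊖ m n ⟩
    m · 1# + - (n · 1#)                ≈⟨ cancel-+ˡ 1# _ _ ⟨
    (1# + m · 1#) + - (1# + n · 1#)    ∎

  ⟦⟧-neg : ∀ i → ⟦ ℤ.- i ⟧ℤ ≈ - ⟦ i ⟧ℤ
  ⟦⟧-neg (+ zero)  = sym -0#≈0#
  ⟦⟧-neg (+ suc n) = refl
  ⟦⟧-neg -[1+ n ]  = sym (-‿involutive _)

  ⟦⟧-+ : ∀ i j → ⟦ i ℤ.+ j ⟧ℤ ≈ ⟦ i ⟧ℤ + ⟦ j ⟧ℤ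
  ⟦⟧-+ (+ m)    (+ n)    = ×-homo-+ 1# m n
  ⟦⟧-+ (+ m)    -[1+ n ] = ⟦⟧-⊖ m (suc n)
  ⟦⟧-+ -[1+ m ] (+ n)    = trans (⟦⟧-⊖ n (suc m)) (+-comm _ _)
  ⟦⟧-+ -[1+ m ] -[1+ n ] = begin
    - (suc (suc (m ℕ.+ n)) · 1#)      ≡⟨ ≡.cong (λ k → - (k · 1#)) (≡.sym (≡.cong suc (ℕ.+-suc m n))) ⟩
    - ((suc m ℕ.+ suc n) · 1#)        ≈⟨ -‿cong (×-homo-+ 1# (suc m) (suc n)) ⟩
    - (suc m · 1# + suc n · 1#)       ≈⟨ -‿+-comm _ _ ⟨
    - (suc m · 1#) + - (suc n · 1#)   ∎

  ⟦⟧-*⁺ : ∀ m j → ⟦ + m ℤ.* j ⟧ℤ ≈ ⟦ + m ⟧ℤ * ⟦ j ⟧ℤ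
  ⟦⟧-*⁺ m (+ n) = begin
    ⟦ + m ℤ.* + n ⟧ℤ     ≡⟨ ≡.cong ⟦_⟧ℤ (≡.sym (ℤ.pos-* m n)) ⟩
    (m ℕ.* n) · 1#       ≈⟨ ×1-homo-* m n ⟩
    m · 1# * n · 1#      ∎
  ⟦⟧-*⁺ m -[1+ n ] = begin
    ⟦ + m ℤ.* ℤ.- (+ suc n) ⟧ℤ       ≡⟨ ≡.cong ⟦_⟧ℤ (≡.sym (ℤ.neg-distribʳ-* (+ m) (+ suc n))) ⟩
    ⟦ ℤ.- (+ m ℤ.* + suc n) ⟧ℤ       ≈⟨ ⟦⟧-neg (+ m ℤ.* + suc n) ⟩
    - ⟦ + m ℤ.* + suc n ⟧ℤ           ≈⟨ -‿cong (⟦⟧-*⁺ m (+ suc n)) ⟩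
    - (m · 1# * suc n · 1#)          ≈⟨ -‿distribʳ-* _ _ ⟩
    m · 1# * - (suc n · 1#)          ∎

  ⟦⟧-* : ∀ i j → ⟦ i ℤ.* j ⟧ℤ ≈ ⟦ i ⟧ℤ * ⟦ j ⟧ℤ
  ⟦⟧-* (+ m)    j = ⟦⟧-*⁺ m j
  ⟦⟧-* -[1+ m ] j = begin
    ⟦ ℤ.- (+ suc m) ℤ.* j ⟧ℤ     ≡⟨ ≡.cong ⟦_⟧ℤ (≡.sym (ℤ.neg-distribˡ-* (+ suc m) j)) ⟩
    ⟦ ℤ.- (+ suc m ℤ.* j) ⟧ℤ     ≈⟨ ⟦⟧-neg (+ suc m ℤ.* j) ⟩
    - ⟦ + suc m ℤ.* j ⟧ℤ         ≈⟨ -‿cong (⟦⟧-*⁺ (suc m) j) ⟩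
    - (suc m · 1# * ⟦ j ⟧ℤ)      ≈⟨ -‿distribˡ-* _ _ ⟩
    - (suc m · 1#) * ⟦ j ⟧ℤ      ∎

  almostCommutativeRing : AlmostCommutativeRing c ℓ
  almostCommutativeRing = fromCommutativeRing R

  -- Agrees with ⟦_⟧ℤ, but sends 1 to 1# instead of 1# + 0#, so that solver
  -- constants match the terms 1# and fromℕ n definitionally.
  ⟦_⟧′ : ℤ → Carrier
  ⟦ + 1 ⟧′ = 1#
  ⟦ i   ⟧′ = ⟦ i ⟧ℤ

  ⟦⟧′-≈ : ∀ i → ⟦ i ⟧′ ≈ ⟦ i ⟧ℤ
  ⟦⟧′-≈ (+ 0)           = refl
  ⟦⟧′-≈ (+ 1)           = sym (+-identityʳ 1#)
  ⟦⟧′-≈ (+ suc (suc n)) = refl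
  ⟦⟧′-≈ -[1+ n ]        = refl

  ℤ⟶R : ℤ.+-*-rawRing -Raw-AlmostCommutative⟶ almostCommutativeRing
  ℤ⟶R = record
    { ⟦_⟧    = ⟦_⟧′
    ; +-homo = λ i j → trans (⟦⟧′-≈ (i ℤ.+ j))
                         (trans (⟦⟧-+ i j) (sym (+-cong (⟦⟧′-≈ i) (⟦⟧′-≈ j))))
    ; *-homo = λ i j → trans (⟦⟧′-≈ (i ℤ.* j))
                         (trans (⟦⟧-* i j) (sym (*-cong (⟦⟧′-≈ i) (⟦⟧′-≈ j))))
    ; -‿homo = λ i → trans (⟦⟧′-≈ (ℤ.- i)) (trans (⟦⟧-neg i) (sym (-‿cong (⟦⟧′-≈ i))))
    ; 0-homo = refl
    ; 1-homo = refl
    }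

  -- Comparing in ℤ lets normal forms compute, which the abstract equality of `R` cannot. Distinct
  -- integers may coincide in `R`; `nothing` is then a sound answer.
  ℤ-coeff≟ : ∀ i j → Maybe (⟦ i ⟧′ ≈ ⟦ j ⟧′)
  ℤ-coeff≟ i j = Maybe.map (λ i≡j → reflexive (≡.cong ⟦_⟧′ i≡j)) (dec⇒maybe (i ℤ.≟ j))

  open import Algebra.Solver.Ring ℤ.+-*-rawRing almostCommutativeRing ℤ⟶R ℤ-coeff≟ public
    using (solve; con; _:=_; _:+_; _:*_; _:-_; :-_; Polynomial)

-- Ordered-field arithmetic.

module OrderedField (ℝ : RealNumbers) where
  open RealNumbers ℝ
  open CommutativeRing commutativeRing public
    using ( refl; sym; trans; reflexive; setoid; semiring
          ; +-cong; +-congˡ; +-congʳ; +-comm; +-assoc; +-identityˡ; +-identityʳ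
          ; *-cong; *-congˡ; *-congʳ; *-comm; *-assoc; *-identityˡ; *-identityʳ
          ; -‿cong; -‿inverseʳ; zeroˡ; zeroʳ )
  open IsDecTotalOrder isDecTotalOrder public
    using (total; antisym; _≤?_; _≟_)
    renaming (refl to ≤-refl; trans to ≤-trans; reflexive to ≤-reflexive; ≤-respˡ-≈ to ≤-respˡ; ≤-respʳ-≈ to ≤-respʳ)
  open IntegerCoefficients commutativeRing public
  open SetoidReasoning setoid

  :0 :1 :2 : ∀ {n} → Polynomial n
  :0 = con (+ 0)
  :1 = con (+ 1)
  :2 = con (+ 2)

  ≤⇒0≤- : ∀ {x y} → x ≤ y → 0# ≤ y - x
  ≤⇒0≤- {x} {y} x≤y = ≤-respˡ (-‿inverseʳ x) (+-monoˡ-≤ (- x) x≤y)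

  0≤-⇒≤ : ∀ {x y} → 0# ≤ y - x → x ≤ y
  0≤-⇒≤ {x} {y} h = ≤-respˡ (+-identityˡ x)
    (≤-respʳ (solve 2 (λ x y → (y :- x) :+ x := y) refl x y) (+-monoˡ-≤ x h))

  ≤-byDifference : ∀ {x y e} → y - x ≈ e → 0# ≤ e → x ≤ y
  ≤-byDifference eq 0≤e = 0≤-⇒≤ (≤-respʳ (sym eq) 0≤e)

  +-nonNeg : ∀ {x y} → 0# ≤ x → 0# ≤ y → 0# ≤ x + y
  +-nonNeg {x} {y} hx hy =
    ≤-trans hy (≤-respˡ (+-identityˡ y) (+-monoˡ-≤ y hx))

  neg-nonNeg : ∀ {x} → x ≤ 0# → 0# ≤ - x
  neg-nonNeg {x} h = ≤-respʳ (+-identityˡ (- x)) (≤⇒0≤- h)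

  square-nonNeg : ∀ x → 0# ≤ x ²
  square-nonNeg x with total 0# x
  ... | inj₁ 0≤x = *-nonNeg 0≤x 0≤x
  ... | inj₂ x≤0 = ≤-respʳ (solve 1 (λ x → :- x :* :- x := x :* x) refl x)
                     (*-nonNeg (neg-nonNeg x≤0) (neg-nonNeg x≤0))

  0≤1 : 0# ≤ 1#
  0≤1 = ≤-respʳ (*-identityˡ 1#) (square-nonNeg 1#)

  -- Strict positivity as a negated inequality; totality of the order recovers `0# ≤ x` from it.
  Positive : Carrier → Set
  Positive x = ¬ (x ≤ 0#)

  positive⇒nonNeg : ∀ {x} → Positive x → 0# ≤ x
  positive⇒nonNeg {x} x>0 with total 0# x
  ... | inj₁ 0≤x = 0≤x
  ... | inj₂ x≤0 = contradiction x≤0 x>0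

  positive⇒≉0 : ∀ {x} → Positive x → ¬ (x ≈ 0#)
  positive⇒≉0 x>0 x≈0 = x>0 (≤-reflexive x≈0)

  ≤-positive : ∀ {x y} → Positive x → x ≤ y → Positive y
  ≤-positive x>0 x≤y y≤0 = x>0 (≤-trans x≤y y≤0)

  nonNeg-split : ∀ {x} → 0# ≤ x → x ≈ 0# ⊎ Positive x
  nonNeg-split {x} 0≤x with x ≤? 0#
  ... | yes x≤0 = inj₁ (antisym x≤0 0≤x)
  ... | no  x>0 = inj₂ x>0

  1-positive : Positive 1#
  1-positive 1≤0 = 0≉1 (antisym 0≤1 1≤0)

  fromℕ-nonNeg : ∀ n → 0# ≤ fromℕ n
  fromℕ-nonNeg zero    = ≤-refl
  fromℕ-nonNeg (suc n) = +-nonNeg 0≤1 (fromℕ-nonNeg n)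

  fromℕ-positive : ∀ n .{{_ : NonZero n}} → Positive (fromℕ n)
  fromℕ-positive (suc n) = ≤-positive 1-positive
    (≤-byDifference (solve 2 (λ x y → (x :+ y) :- x := y) refl 1# (fromℕ n)) (fromℕ-nonNeg n))

  *-cancelˡ-≈0 : ∀ {z x} → ¬ (z ≈ 0#) → z * x ≈ 0# → x ≈ 0#
  *-cancelˡ-≈0 {z} {x} z≉0 zx≈0 = begin
    x               ≈⟨ *-identityˡ x ⟨
    1# * x          ≈⟨ *-congʳ (*-inverseʳ z z≉0) ⟨
    (z * z ⁻¹) * x  ≈⟨ solve 3 (λ z i x → (z :* i) :* x := i :* (z :* x)) refl z (z ⁻¹) x ⟩
    z ⁻¹ * (z * x)  ≈⟨ *-congˡ zx≈0 ⟩
    z ⁻¹ * 0#       ≈⟨ zeroʳ _ ⟩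
    0#              ∎

  -≈0⇒≈ : ∀ {x y} → x - y ≈ 0# → x ≈ y
  -≈0⇒≈ {x} {y} h = begin
    x           ≈⟨ solve 2 (λ x y → x := (x :- y) :+ y) refl x y ⟩
    x - y + y   ≈⟨ +-congʳ h ⟩
    0# + y      ≈⟨ +-identityˡ y ⟩
    y           ∎

  ≈⇒-≈0 : ∀ {x y} → x ≈ y → x - y ≈ 0#
  ≈⇒-≈0 {x} {y} h = trans (+-congʳ h) (-‿inverseʳ y)

  *-cancelˡ-≈ : ∀ {z x y} → ¬ (z ≈ 0#) → z * x ≈ z * y → x ≈ y
  *-cancelˡ-≈ {z} {x} {y} z≉0 eq = -≈0⇒≈ (*-cancelˡ-≈0 z≉0
    (trans (solve 3 (λ z x y → z :* (x :- y) := z :* x :- z :* y) refl z x y) (≈⇒-≈0 eq)))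

  *-cancelˡ-nonNeg : ∀ {z x} → Positive z → 0# ≤ z * x → 0# ≤ x
  *-cancelˡ-nonNeg {z} {x} z>0 0≤zx with total 0# x
  ... | inj₁ 0≤x = 0≤x
  ... | inj₂ x≤0 = ≤-reflexive (sym (*-cancelˡ-≈0 (positive⇒≉0 z>0) (antisym zx≤0 0≤zx)))
    where
    zx≤0 : z * x ≤ 0#
    zx≤0 = ≤-byDifference (solve 2 (λ z x → :0 :- z :* x := z :* :- x) refl z x)
             (*-nonNeg (positive⇒nonNeg z>0) (neg-nonNeg x≤0))

  *-cancelˡ-≤ : ∀ {z x y} → Positive z → z * x ≤ z * y → x ≤ y
  *-cancelˡ-≤ {z} {x} {y} z>0 h = 0≤-⇒≤ (*-cancelˡ-nonNeg z>0
    (≤-respʳ (solve 3 (λ z x y → z :* y :- z :* x := z :* (y :- x)) refl z x y) (≤⇒0≤- h)))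

  *-monoˡ-≤ : ∀ {z x y} → 0# ≤ z → x ≤ y → z * x ≤ z * y
  *-monoˡ-≤ {z} {x} {y} 0≤z h =
    ≤-byDifference (solve 3 (λ z x y → z :* y :- z :* x := z :* (y :- x)) refl z x y)
      (*-nonNeg 0≤z (≤⇒0≤- h))

  +-mono-≤ : ∀ {x y u v} → x ≤ y → u ≤ v → x + u ≤ y + v
  +-mono-≤ {x} {y} {u} {v} h k =
    ≤-byDifference (solve 4 (λ x y u v → (y :+ v) :- (x :+ u) := (y :- x) :+ (v :- u)) refl x y u v)
      (+-nonNeg (≤⇒0≤- h) (≤⇒0≤- k))

  *-mono-≤ : ∀ {x y u v} → 0# ≤ x → 0# ≤ u → x ≤ y → u ≤ v → x * u ≤ y * v
  *-mono-≤ {x} {y} {u} {v} 0≤x 0≤u h k =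
    ≤-byDifference (solve 4 (λ x y u v → y :* v :- x :* u :=
                      ((y :- x) :* (v :- u) :+ (y :- x) :* u) :+ x :* (v :- u)) refl x y u v)
      (+-nonNeg (+-nonNeg (*-nonNeg (≤⇒0≤- h) (≤⇒0≤- k)) (*-nonNeg (≤⇒0≤- h) 0≤u))
                (*-nonNeg 0≤x (≤⇒0≤- k)))

  positive-* : ∀ {x y} → Positive x → Positive y → Positive (x * y)
  positive-* {x} {y} x>0 y>0 xy≤0 = positive⇒≉0 y>0 (*-cancelˡ-≈0 (positive⇒≉0 x>0)
    (antisym xy≤0 (*-nonNeg (positive⇒nonNeg x>0) (positive⇒nonNeg y>0))))

  -- If `x ≤ y` failed, `x` and hence `x + y` would be positive and could be cancelled from y² - x²
  -- = (x + y)(y - x).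
  ≤-fromSquares : ∀ {x y} → 0# ≤ y → x ² ≤ y ² → x ≤ y
  ≤-fromSquares {x} {y} 0≤y x²≤y² with x ≤? y
  ... | yes x≤y = x≤y
  ... | no  x≰y = contradiction (0≤-⇒≤ y-x≥0) x≰y
    where
    x>0 : Positive x
    x>0 x≤0 = x≰y (≤-trans x≤0 0≤y)
    y-x≥0 : 0# ≤ y - x
    y-x≥0 = *-cancelˡ-nonNeg
      (≤-positive x>0 (≤-byDifference (solve 2 (λ x y → (x :+ y) :- x := y) refl x y) 0≤y))
      (≤-respʳ (solve 2 (λ x y → y :* y :- x :* x := (x :+ y) :* (y :- x)) refl x y) (≤⇒0≤- x²≤y²))

  *-/-cancel : ∀ x y → ¬ (y ≈ 0#) → y * (x / y) ≈ x
  *-/-cancel x y y≉0 = begin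
    y * (x * y ⁻¹)   ≈⟨ solve 3 (λ x y i → y :* (x :* i) := (y :* i) :* x) refl x y (y ⁻¹) ⟩
    (y * y ⁻¹) * x   ≈⟨ *-congʳ (*-inverseʳ y y≉0) ⟩
    1# * x           ≈⟨ *-identityˡ x ⟩
    x                ∎

  -- Square roots from suprema.

  module SquareRoot {x : Carrier} (0≤x : 0# ≤ x) where
    private
      k : Carrier
      -- Its square is at least `x`, so it bounds the set whose supremum is `√ x`; the same
      -- inequality controls the map that defines `y`.
      k = 1# + x

      x≤k² : 0# ≤ k ² - x
      x≤k² = ≤-respʳ (solve 1 (λ x → (:1 :+ x) :+ x :* x := (:1 :+ x) :* (:1 :+ x) :- x) refl x)
               (+-nonNeg (+-nonNeg 0≤1 0≤x) (square-nonNeg x))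

      k≥0 : 0# ≤ k
      k≥0 = +-nonNeg 0≤1 0≤x

      isLUB : IsLeastUpperBound (λ y → y ² ≤ x) (√ x)
      isLUB = sup-isLUB _ (0# , ≤-respˡ (sym (zeroˡ 0#)) 0≤x)
                (k , λ y y²≤x → ≤-fromSquares k≥0 (≤-trans y²≤x (0≤-⇒≤ x≤k²)))

    √-nonNeg : 0# ≤ √ x
    √-nonNeg = proj₁ isLUB 0# (≤-respˡ (sym (zeroˡ 0#)) 0≤x)

    private
      s w y : Carrier
      s = √ x
      w = s + k
      y = (s * k + x) / w

      w>0 : Positive w
      w>0 = ≤-positive 1-positive
        (≤-byDifference (solve 2 (λ s x → (s :+ (:1 :+ x)) :- :1 := s :+ x) refl s x)
          (+-nonNeg √-nonNeg 0≤x))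

      wy≈ : w * y ≈ s * k + x
      wy≈ = *-/-cancel _ w (positive⇒≉0 w>0)

      -- The Möbius map s ↦ (s k + x) / (s + k) moves s towards the fixed
      -- point √ x without crossing it, since x ≤ k².
      w[y-s] : w * (y - s) ≈ x - s ²
      w[y-s] = begin
        w * (y - s)             ≈⟨ solve 3 (λ w y s → w :* (y :- s) := w :* y :- w :* s) refl w y s ⟩
        w * y - w * s           ≈⟨ +-congʳ wy≈ ⟩
        (s * k + x) - w * s     ≈⟨ solve 3 (λ s k x → (s :* k :+ x) :- (s :+ k) :* s := x :- s :* s) refl s k x ⟩
        x - s ²                 ∎

      w²[x-y²] : w ² * (x - y ²) ≈ (k ² - x) * (x - s ²)
      w²[x-y²] = begin
        w ² * (x - y ²)
          ≈⟨ solve 3 (λ w y x → (w :* w) :* (x :- y :* y) := (w :* w) :* x :- (w :* y) :* (w :* y)) refl w y x ⟩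
        w ² * x - (w * y) ²
          ≈⟨ +-congˡ (-‿cong (*-cong wy≈ wy≈)) ⟩
        w ² * x - (s * k + x) ²
          ≈⟨ solve 3 (λ s k x → ((s :+ k) :* (s :+ k)) :* x :- (s :* k :+ x) :* (s :* k :+ x)
                             := (k :* k :- x) :* (x :- s :* s)) refl s k x ⟩
        (k ² - x) * (x - s ²) ∎

      w²>0 : Positive (w ²)
      w²>0 = positive-* w>0 w>0

    -- If s² ≤ x, then `y` is in the set and `s ≤ y`; if x ≤ s², then `y` is an upper bound of the
    -- set and `y ≤ s`. In both cases the supremum property forces `y ≈ s`, and `w[y-s]` turns this
    -- into x - s² = 0.
    √-square : (√ x) ² ≈ x
    √-square with total (s ²) x
    ... | inj₁ s²≤x = sym (-≈0⇒≈ (trans (sym w[y-s]) (trans (*-congˡ (≈⇒-≈0 y≈s)) (zeroʳ w))))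
      where
      y²≤x : y ² ≤ x
      y²≤x = 0≤-⇒≤ (*-cancelˡ-nonNeg w²>0
        (≤-respʳ (sym w²[x-y²]) (*-nonNeg x≤k² (≤⇒0≤- s²≤x))))
      y≈s : y ≈ s
      y≈s = antisym (proj₁ isLUB y y²≤x)
        (0≤-⇒≤ (*-cancelˡ-nonNeg w>0 (≤-respʳ (sym w[y-s]) (≤⇒0≤- s²≤x))))
    ... | inj₂ x≤s² = sym (-≈0⇒≈ (trans (sym w[y-s]) (trans (*-congˡ (≈⇒-≈0 y≈s)) (zeroʳ w))))
      where
      y≥0 : 0# ≤ y
      y≥0 = *-cancelˡ-nonNeg w>0 (≤-respʳ (sym wy≈) (+-nonNeg (*-nonNeg √-nonNeg k≥0) 0≤x))
      x≤y² : x ≤ y ²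
      x≤y² = 0≤-⇒≤ (*-cancelˡ-nonNeg w²>0 (≤-respʳ (begin
        (k ² - x) * (s ² - x)    ≈⟨ solve 3 (λ p s x → p :* (s :- x) := :- (p :* (x :- s))) refl (k ² - x) (s ²) x ⟩
        - ((k ² - x) * (x - s ²)) ≈⟨ -‿cong w²[x-y²] ⟨
        - (w ² * (x - y ²))       ≈⟨ solve 3 (λ w x y → :- (w :* (x :- y)) := w :* (y :- x)) refl (w ²) x (y ²) ⟩
        w ² * (y ² - x)           ∎) (*-nonNeg x≤k² (≤⇒0≤- x≤s²))))
      y≈s : y ≈ s
      y≈s = antisym
        (0≤-⇒≤ (*-cancelˡ-nonNeg w>0 (≤-respʳ (trans (-‿cong (sym w[y-s]))
             (solve 3 (λ w y s → :- (w :* (y :- s)) := w :* (s :- y)) refl w y s))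
             (≤-respʳ (solve 2 (λ a b → a :- b := :- (b :- a)) refl (s ²) x) (≤⇒0≤- x≤s²)))))
        (proj₂ isLUB y (λ z z²≤x → ≤-fromSquares y≥0 (≤-trans z²≤x x≤y²)))

  open SquareRoot public using (√-nonNeg; √-square)

-- Inner products, Cauchy-Schwarz and polarization.

module InnerProducts (ℝ : RealNumbers) where
  open RealNumbers ℝ
  open OrderedField ℝ
  open SetoidReasoning setoid

  square≈0 : ∀ {x} → x ² ≈ 0# → x ≈ 0#
  square≈0 {x} x²≈0 with x ≟ 0#
  ... | yes x≈0 = x≈0
  ... | no  x≉0 = *-cancelˡ-≈0 x≉0 x²≈0

  -- Abstracting the index set lets one inner-product calculus serve vertices, `Fin n`, and edge
  -- ends, `Fin m × Fin n`.
  record Summation (I : Set) : Set where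
    field
      ∑          : (I → Carrier) → Carrier
      ∑-cong     : ∀ {f g} → (∀ i → f i ≈ g i) → ∑ f ≈ ∑ g
      ∑-+        : ∀ f g → ∑ (λ i → f i + g i) ≈ ∑ f + ∑ g
      ∑-*        : ∀ x f → ∑ (λ i → x * f i) ≈ x * ∑ f
      ∑-nonNeg   : ∀ {f} → (∀ i → 0# ≤ f i) → 0# ≤ ∑ f
      ∑-definite : ∀ {f} → (∀ i → 0# ≤ f i) → ∑ f ≈ 0# → ∀ i → f i ≈ 0#

    infix 8 ⟪_,_⟫
    ⟪_,_⟫ : (I → Carrier) → (I → Carrier) → Carrier
    ⟪ x , y ⟫ = ∑ (λ i → x i * y i)

    infix 8 _∙_+_∙_
    -- One four-place operator makes sums, differences and scalings instances of a single bilinear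
    -- expansion, whose scalars the ring solver can then handle.
    _∙_+_∙_ : Carrier → (I → Carrier) → Carrier → (I → Carrier) → I → Carrier
    (s ∙ x + t ∙ y) i = s * x i + t * y i

    ⟪⟫-cong : ∀ {x x′ y y′} → (∀ i → x i ≈ x′ i) → (∀ i → y i ≈ y′ i) → ⟪ x , y ⟫ ≈ ⟪ x′ , y′ ⟫
    ⟪⟫-cong p q = ∑-cong (λ i → *-cong (p i) (q i))

    ⟪⟫-comm : ∀ x y → ⟪ x , y ⟫ ≈ ⟪ y , x ⟫
    ⟪⟫-comm x y = ∑-cong (λ i → *-comm (x i) (y i))

    ∑-linear : ∀ s x t y → ∑ (s ∙ x + t ∙ y) ≈ s * ∑ x + t * ∑ y
    ∑-linear s x t y = trans (∑-+ _ _) (+-cong (∑-* s x) (∑-* t y))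

    ⟪⟫-linearˡ : ∀ s x t y z → ⟪ s ∙ x + t ∙ y , z ⟫ ≈ s * ⟪ x , z ⟫ + t * ⟪ y , z ⟫
    ⟪⟫-linearˡ s x t y z = trans
      (∑-cong (λ i → solve 5 (λ s x t y z → (s :* x :+ t :* y) :* z := s :* (x :* z) :+ t :* (y :* z))
                       refl s (x i) t (y i) (z i)))
      (∑-linear s _ t _)

    ⟪⟫-linearʳ : ∀ s x t y z → ⟪ z , s ∙ x + t ∙ y ⟫ ≈ s * ⟪ z , x ⟫ + t * ⟪ z , y ⟫
    ⟪⟫-linearʳ s x t y z = trans (⟪⟫-comm z _) (trans (⟪⟫-linearˡ s x t y z)
      (+-cong (*-congˡ (⟪⟫-comm x z)) (*-congˡ (⟪⟫-comm y z))))

    ⟪⟫-bilinear : ∀ s x t y s′ x′ t′ y′ → ⟪ s ∙ x + t ∙ y , s′ ∙ x′ + t′ ∙ y′ ⟫ ≈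
      s * (s′ * ⟪ x , x′ ⟫ + t′ * ⟪ x , y′ ⟫) + t * (s′ * ⟪ y , x′ ⟫ + t′ * ⟪ y , y′ ⟫)
    ⟪⟫-bilinear s x t y s′ x′ t′ y′ = trans (⟪⟫-linearˡ s x t y _)
      (+-cong (*-congˡ (⟪⟫-linearʳ s′ x′ t′ y′ x)) (*-congˡ (⟪⟫-linearʳ s′ x′ t′ y′ y)))

    ⟪⟫-negˡ : ∀ x y → ⟪ (λ i → - x i) , y ⟫ ≈ - ⟪ x , y ⟫
    ⟪⟫-negˡ x y = begin
      ⟪ (λ i → - x i) , y ⟫
        ≈⟨ ∑-cong (λ i → solve 2 (λ x y → :- x :* y := :- :1 :* (x :* y)) refl (x i) (y i)) ⟩
      ∑ (λ i → - 1# * (x i * y i))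
        ≈⟨ ∑-* _ _ ⟩
      - 1# * ⟪ x , y ⟫
        ≈⟨ solve 1 (λ x → :- :1 :* x := :- x) refl _ ⟩
      - ⟪ x , y ⟫ ∎

    ⟪⟫-negʳ : ∀ x y → ⟪ x , (λ i → - y i) ⟫ ≈ - ⟪ x , y ⟫
    ⟪⟫-negʳ x y = trans (⟪⟫-comm x _) (trans (⟪⟫-negˡ y x) (-‿cong (⟪⟫-comm y x)))

    ⟪⟫-nonNeg : ∀ x → 0# ≤ ⟪ x , x ⟫
    ⟪⟫-nonNeg x = ∑-nonNeg (λ i → square-nonNeg (x i))

    ⟪⟫-definite : ∀ {x} → ⟪ x , x ⟫ ≤ 0# → ∀ i → x i ≈ 0#
    ⟪⟫-definite {x} h i = square≈0
      (∑-definite (λ i → square-nonNeg (x i)) (antisym h (⟪⟫-nonNeg x)) i)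

    ⟪⟫-zeroˡ : ∀ {x} y → (∀ i → x i ≈ 0#) → ⟪ x , y ⟫ ≈ 0#
    ⟪⟫-zeroˡ {x} y x≈0 = begin
      ⟪ x , y ⟫             ≈⟨ ∑-cong (λ i → *-congʳ (x≈0 i)) ⟩
      ∑ (λ i → 0# * y i)    ≈⟨ ∑-* 0# y ⟩
      0# * ∑ y              ≈⟨ zeroˡ _ ⟩
      0#                    ∎

    -- Expand ‖l x - y‖² ≥ 0, replace ‖y‖² by its bound and cancel 2 l. When `l ≈ 0#` there is
    -- nothing to cancel, but the hypothesis makes `y` vanish.
    cauchySchwarz : ∀ {l} x y → 0# ≤ l → ⟪ y , y ⟫ ≤ l ² * ⟪ x , x ⟫ → ⟪ y , x ⟫ ≤ l * ⟪ x , x ⟫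
    cauchySchwarz {l} x y 0≤l h with nonNeg-split 0≤l
    ... | inj₁ l≈0 = ≤-reflexive (trans (⟪⟫-zeroˡ x y≈0) (sym (trans (*-congʳ l≈0) (zeroˡ _))))
      where
      y≈0 : ∀ i → y i ≈ 0#
      y≈0 = ⟪⟫-definite (≤-respʳ (trans (*-congʳ (trans (*-congʳ l≈0) (zeroˡ l))) (zeroˡ _)) h)
    ... | inj₂ l>0 = *-cancelˡ-≤ (positive-* (fromℕ-positive 2) l>0)
      (≤-byDifference
        (solve 4 (λ l r c s → (:2 :* l) :* (l :* r) :- (:2 :* l) :* c :=
             ((l :* l) :* r :- s) :+
             (l :* (l :* r :+ :- :1 :* c) :+ :- :1 :* (l :* c :+ :- :1 :* s)))
           refl l ⟪ x , x ⟫ ⟪ y , x ⟫ ⟪ y , y ⟫)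
        (+-nonNeg (≤⇒0≤- h)
          (≤-respʳ (trans (⟪⟫-bilinear l x (- 1#) y l x (- 1#) y)
                      (+-congʳ (*-congˡ (+-congˡ (*-congˡ (⟪⟫-comm x y))))))
             (⟪⟫-nonNeg (l ∙ x + - 1# ∙ y)))))

    cauchySchwarz± : ∀ {l} x y → 0# ≤ l → ⟪ y , y ⟫ ≤ l ² * ⟪ x , x ⟫ →
                     ⟪ y , x ⟫ ≤ l * ⟪ x , x ⟫ × - ⟪ y , x ⟫ ≤ l * ⟪ x , x ⟫
    cauchySchwarz± x y 0≤l h = cauchySchwarz x y 0≤l h ,
      ≤-respˡ (⟪⟫-negˡ y x) (cauchySchwarz x (λ i → - y i) 0≤l
        (≤-respˡ (∑-cong (λ i → solve 1 (λ y → y :* y := :- y :* :- y) refl (y i))) h))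

    -- Polarize at f x ± M x; if f = 0, at x ± M x.
    normFromForm : ∀ (W : (I → Carrier) → Set) (M : (I → Carrier) → I → Carrier) f → 0# ≤ f →
      (∀ s x t y → W x → W y → W (s ∙ x + t ∙ y)) →
      (∀ x → W x → W (M x)) →
      (∀ s x t y i → M (s ∙ x + t ∙ y) i ≈ (s ∙ M x + t ∙ M y) i) →
      (∀ x y → ⟪ M x , y ⟫ ≈ ⟪ x , M y ⟫) →
      (∀ x → W x → ⟪ M x , x ⟫ ≤ f * ⟪ x , x ⟫ × - ⟪ M x , x ⟫ ≤ f * ⟪ x , x ⟫) →
      ∀ x → W x → ⟪ M x , M x ⟫ ≤ f ² * ⟪ x , x ⟫
    normFromForm W M f 0≤f W-linear W-M M-linear M-sym form x x∈W = conclude (nonNeg-split 0≤f)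
      where
      y = M x
      r = ⟪ x , x ⟫
      s = ⟪ y , y ⟫
      c = ⟪ y , x ⟫
      e = ⟪ M y , y ⟫

      form-expand : ∀ t u → ⟪ M (t ∙ x + u ∙ y) , t ∙ x + u ∙ y ⟫ ≈
                    t * (t * c + u * s) + u * (t * s + u * e)
      form-expand t u = trans (⟪⟫-cong (M-linear t x u y) (λ _ → refl))
        (trans (⟪⟫-bilinear t y u (M y) t x u y)
          (+-congˡ (*-congˡ (+-congʳ (*-congˡ (M-sym y x))))))

      norm-expand : ∀ t u → ⟪ t ∙ x + u ∙ y , t ∙ x + u ∙ y ⟫ ≈
                    t * (t * r + u * c) + u * (t * c + u * s)
      norm-expand t u = trans (⟪⟫-bilinear t x u y t x u y)
        (+-congʳ (*-congˡ (+-congˡ (*-congˡ (⟪⟫-comm x y)))))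

      upper : ∀ t u → t * (t * c + u * s) + u * (t * s + u * e) ≤
                      f * (t * (t * r + u * c) + u * (t * c + u * s))
      upper t u = ≤-respˡ (form-expand t u) (≤-respʳ (*-congˡ (norm-expand t u))
        (proj₁ (form _ (W-linear t x u y x∈W (W-M x x∈W)))))

      lower : ∀ t u → - (t * (t * c + u * s) + u * (t * s + u * e)) ≤
                      f * (t * (t * r + u * c) + u * (t * c + u * s))
      lower t u = ≤-respˡ (-‿cong (form-expand t u)) (≤-respʳ (*-congˡ (norm-expand t u))
        (proj₂ (form _ (W-linear t x u y x∈W (W-M x x∈W)))))

      -- Adding the upper bound at t x + M x to the lower bound at t x - M x cancels every term in
      -- `c` and `e`, so nothing has to be known about ⟪ M y , y ⟫.
      polarized : ∀ t → fromℕ 2 * (fromℕ 2 * (t * s)) ≤ fromℕ 2 * (f * (t * t * r + s))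
      polarized t = ≤-byDifference
        (solve 6 (λ t f r c s e →
           :2 :* (f :* (t :* t :* r :+ s)) :- :2 :* (:2 :* (t :* s)) :=
             (f :* (t :* (t :* r :+ :1 :* c) :+ :1 :* (t :* c :+ :1 :* s))
               :- (t :* (t :* c :+ :1 :* s) :+ :1 :* (t :* s :+ :1 :* e)))
             :+ (f :* (t :* (t :* r :+ :- :1 :* c) :+ :- :1 :* (t :* c :+ :- :1 :* s))
               :- :- (t :* (t :* c :+ :- :1 :* s) :+ :- :1 :* (t :* s :+ :- :1 :* e))))
           refl t f r c s e)
        (+-nonNeg (≤⇒0≤- (upper t 1#)) (≤⇒0≤- (lower t (- 1#))))

      polarized′ : ∀ t → fromℕ 2 * (t * s) ≤ f * (t * t * r + s)
      polarized′ t = *-cancelˡ-≤ (fromℕ-positive 2) (polarized t)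

      conclude : f ≈ 0# ⊎ Positive f → s ≤ f ² * r
      conclude (inj₁ f≈0) = ≤-respʳ (sym (trans (*-congʳ (trans (*-congʳ f≈0) (zeroˡ f))) (zeroˡ r)))
        (*-cancelˡ-≤ (fromℕ-positive 2)
          (≤-respˡ (*-congˡ (*-identityˡ s))
            (≤-respʳ (trans (trans (*-congʳ f≈0) (zeroˡ _)) (sym (zeroʳ _))) (polarized′ 1#))))
      conclude (inj₂ f>0) = *-cancelˡ-≤ f>0
        (≤-byDifference
          (solve 3 (λ f r s → f :* ((f :* f) :* r) :- f :* s := f :* (f :* f :* r :+ s) :- :2 :* (f :* s))
             refl f r s)
          (≤⇒0≤- (polarized′ f)))

-- The quadratic form of a symmetric isometry on an orthogonal pair.

module ReflectionForm (ℝ : RealNumbers) where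
  open RealNumbers ℝ
  open OrderedField ℝ
  open InnerProducts ℝ
  open SetoidReasoning setoid

  -- The properties of `f` that the certificate uses, detached from its closed form. `L≤f` makes f
  -- ‖v‖² - L ⟪ v , T v ⟫ nonnegative; `≤f` serves the degenerate case `L ≈ 0#`, where it reads
  -- `a ≤ f`.
  record BoundEquation (a L f : Carrier) : Set where
    field
      a≥0  : 0# ≤ a
      L≥0  : 0# ≤ L
      L≤f  : L ≤ f
      ≤f   : (1# - L) * a ≤ f
      root : f ² ≈ (1# - L) * a * f + L

  -- Linearity and T (T x) = x follow from these two laws, but are needed only under inner products,
  -- where the laws give them directly.
  record IsReflection {I : Set} (S : Summation I) (T : (I → Carrier) → I → Carrier) : Set where
    open Summation S
    field
      isometry  : ∀ x y → ⟪ T x , T y ⟫ ≈ ⟪ x , y ⟫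
      symmetric : ∀ x y → ⟪ T x , y ⟫ ≈ ⟪ x , T y ⟫

  -- A lower bound on the form of `T` is an upper bound on the form of its negative, so only one
  -- sign needs a certificate.
  negate-reflection : ∀ {I} {S : Summation I} {T} → IsReflection S T →
                      IsReflection S (λ x i → - T x i)
  negate-reflection {S = S} {T} R = record
    { isometry  = λ x y → trans (⟪⟫-negˡ _ _) (trans (-‿cong (⟪⟫-negʳ _ _))
                    (trans (solve 1 (λ z → :- :- z := z) refl _) (isometry x y)))
    ; symmetric = λ x y → trans (⟪⟫-negˡ _ _) (trans (-‿cong (symmetric x y)) (sym (⟪⟫-negʳ _ _)))
    }
    where
    open Summation S
    open IsReflection R

  module _ {I : Set} (S : Summation I) {T : (I → Carrier) → I → Carrier} (R : IsReflection S T)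
           {a L f : Carrier} (B : BoundEquation a L f) where
    open Summation S
    open IsReflection R
    open BoundEquation B

    module Certificate (x y : I → Carrier)
      (x⊥y : ⟪ x , y ⟫ ≈ 0#) (Tx,x : ⟪ T x , x ⟫ ≤ a * ⟪ x , x ⟫) where

      p q a′ c d g : Carrier
      p  = ⟪ x , x ⟫
      q  = ⟪ y , y ⟫
      a′ = ⟪ T x , x ⟫
      c  = ⟪ T x , y ⟫
      d  = ⟪ T y , y ⟫
      -- With w = T x - a x orthogonal to x, the part of T w orthogonal to x is - a w. Stationarity
      -- in y, f y = L (w + (T y)⊥), is therefore solved by (f + a L) y = L w.
      g  = f + a * L

      f≥0 : 0# ≤ f
      f≥0 = ≤-trans L≥0 L≤f

      -- v vanishes at the y that maximizes the form for a given x, provided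
      -- that ⟪ T x , x ⟫ = a ⟪ x , x ⟫.
      u ũ v ṽ : I → Carrier
      u = a ∙ x + - 1# ∙ T x
      ũ = a ∙ T x + - 1# ∙ x
      v = g ∙ y + L ∙ u
      ṽ = g ∙ T y + L ∙ ũ

      yu : ⟪ y , u ⟫ ≈ - c
      yu = begin
        ⟪ y , u ⟫                          ≈⟨ ⟪⟫-linearʳ a x (- 1#) (T x) y ⟩
        a * ⟪ y , x ⟫ + - 1# * ⟪ y , T x ⟫ ≈⟨ +-cong (*-congˡ (trans (⟪⟫-comm y x) x⊥y)) (*-congˡ (⟪⟫-comm y (T x))) ⟩
        a * 0# + - 1# * c                  ≈⟨ solve 2 (λ a c → a :* :0 :+ :- :1 :* c := :- c) refl a c ⟩
        - c                                ∎

      uu : ⟪ u , u ⟫ ≈ a * (a * p + - 1# * a′) + - 1# * (a * a′ + - 1# * p)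
      uu = trans (⟪⟫-bilinear a x (- 1#) (T x) a x (- 1#) (T x))
        (+-cong (*-congˡ (+-congˡ (*-congˡ (⟪⟫-comm x (T x)))))
                (*-congˡ (+-congˡ (*-congˡ (isometry x x)))))

      vv : ⟪ v , v ⟫ ≈ g * (g * q + L * - c) + L * (g * - c + L * (a * (a * p + - 1# * a′) + - 1# * (a * a′ + - 1# * p)))
      vv = trans (⟪⟫-bilinear g y L u g y L u)
        (+-cong (*-congˡ (+-congˡ (*-congˡ yu)))
                (*-congˡ (+-cong (*-congˡ (trans (⟪⟫-comm u y) yu)) (*-congˡ uu))))

      ũTy : ⟪ ũ , T y ⟫ ≈ - c
      ũTy = begin
        ⟪ ũ , T y ⟫                                ≈⟨ ⟪⟫-linearˡ a (T x) (- 1#) x (T y) ⟩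
        a * ⟪ T x , T y ⟫ + - 1# * ⟪ x , T y ⟫     ≈⟨ +-cong (*-congˡ (trans (isometry x y) x⊥y)) (*-congˡ (sym (symmetric x y))) ⟩
        a * 0# + - 1# * c                          ≈⟨ solve 2 (λ a c → a :* :0 :+ :- :1 :* c := :- c) refl a c ⟩
        - c                                        ∎

      ũũ : ⟪ ũ , ũ ⟫ ≈ a * (a * p + - 1# * a′) + - 1# * (a * a′ + - 1# * p)
      ũũ = trans (⟪⟫-bilinear a (T x) (- 1#) x a (T x) (- 1#) x)
        (+-cong (*-congˡ (+-congʳ (*-congˡ (isometry x x))))
                (*-congˡ (+-congʳ (*-congˡ (⟪⟫-comm x (T x))))))

      -- `ṽ` is T v multiplied out with T (T x) = x, just as `ũ` is T u; hence the equal norms.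
      ṽṽ : ⟪ ṽ , ṽ ⟫ ≈ ⟪ v , v ⟫
      ṽṽ = trans (⟪⟫-bilinear g (T y) L ũ g (T y) L ũ) (trans
        (+-cong (*-congˡ (+-cong (*-congˡ (isometry y y)) (*-congˡ (trans (⟪⟫-comm (T y) ũ) ũTy))))
                (*-congˡ (+-cong (*-congˡ ũTy) (*-congˡ ũũ))))
        (sym vv))

      yũ : ⟪ y , ũ ⟫ ≈ a * c
      yũ = begin
        ⟪ y , ũ ⟫                          ≈⟨ ⟪⟫-linearʳ a (T x) (- 1#) x y ⟩
        a * ⟪ y , T x ⟫ + - 1# * ⟪ y , x ⟫ ≈⟨ +-cong (*-congˡ (⟪⟫-comm y (T x))) (*-congˡ (trans (⟪⟫-comm y x) x⊥y)) ⟩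
        a * c + - 1# * 0#                  ≈⟨ solve 2 (λ a c → a :* c :+ :- :1 :* :0 := a :* c) refl a c ⟩
        a * c                              ∎

      uTy : ⟪ u , T y ⟫ ≈ a * c
      uTy = begin
        ⟪ u , T y ⟫                                ≈⟨ ⟪⟫-linearˡ a x (- 1#) (T x) (T y) ⟩
        a * ⟪ x , T y ⟫ + - 1# * ⟪ T x , T y ⟫     ≈⟨ +-cong (*-congˡ (sym (symmetric x y))) (*-congˡ (trans (isometry x y) x⊥y)) ⟩
        a * c + - 1# * 0#                          ≈⟨ solve 2 (λ a c → a :* c :+ :- :1 :* :0 := a :* c) refl a c ⟩
        a * c                                      ∎

      uũ : ⟪ u , ũ ⟫ ≈ a * (a * a′ + - 1# * p) + - 1# * (a * p + - 1# * a′)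
      uũ = trans (⟪⟫-bilinear a x (- 1#) (T x) a (T x) (- 1#) x)
        (+-cong (*-congˡ (+-congʳ (*-congˡ (⟪⟫-comm x (T x)))))
                (*-congˡ (+-congʳ (*-congˡ (isometry x x)))))

      vṽ : ⟪ v , ṽ ⟫ ≈ g * (g * d + L * (a * c)) + L * (g * (a * c) + L * (a * (a * a′ + - 1# * p) + - 1# * (a * p + - 1# * a′)))
      vṽ = trans (⟪⟫-bilinear g y L u g (T y) L ũ)
        (+-cong (*-congˡ (+-cong (*-congˡ (⟪⟫-comm y (T y))) (*-congˡ yũ)))
                (*-congˡ (+-cong (*-congˡ uTy) (*-congˡ uũ))))

      -- Since `v` and `ṽ` have equal norms, twice the difference is ‖v - ṽ‖².
      vṽ≤vv : 0# ≤ ⟪ v , v ⟫ - ⟪ v , ṽ ⟫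
      vṽ≤vv = *-cancelˡ-nonNeg (fromℕ-positive 2) (≤-respʳ
        (begin
          ⟪ 1# ∙ v + - 1# ∙ ṽ , 1# ∙ v + - 1# ∙ ṽ ⟫
            ≈⟨ ⟪⟫-bilinear 1# v (- 1#) ṽ 1# v (- 1#) ṽ ⟩
          1# * (1# * ⟪ v , v ⟫ + - 1# * ⟪ v , ṽ ⟫) + - 1# * (1# * ⟪ ṽ , v ⟫ + - 1# * ⟪ ṽ , ṽ ⟫)
            ≈⟨ +-congˡ (*-congˡ (+-cong (*-congˡ (⟪⟫-comm ṽ v)) (*-congˡ ṽṽ))) ⟩
          1# * (1# * ⟪ v , v ⟫ + - 1# * ⟪ v , ṽ ⟫) + - 1# * (1# * ⟪ v , ṽ ⟫ + - 1# * ⟪ v , v ⟫)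
            ≈⟨ solve 2 (λ P Q → :1 :* (:1 :* P :+ :- :1 :* Q) :+ :- :1 :* (:1 :* Q :+ :- :1 :* P)
                   := :2 :* (P :- Q)) refl ⟪ v , v ⟫ ⟪ v , ṽ ⟫ ⟩
          fromℕ 2 * (⟪ v , v ⟫ - ⟪ v , ṽ ⟫) ∎)
        (⟪⟫-nonNeg (1# ∙ v + - 1# ∙ ṽ)))

      -- The first two terms add up to f ‖v‖² - L ⟪ v , T v ⟫, split so that each is visibly
      -- nonnegative. The last one pays for ⟪ T x , x ⟫ falling short of a ‖x‖².
      slack : 0# ≤ (f - L) * ⟪ v , v ⟫ + L * (⟪ v , v ⟫ - ⟪ v , ṽ ⟫) + L * ((f - L) * (f + L)) * (a * p - a′)
      slack = +-nonNeg
        (+-nonNeg (*-nonNeg (≤⇒0≤- L≤f) (⟪⟫-nonNeg v)) (*-nonNeg L≥0 vṽ≤vv))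
        (*-nonNeg (*-nonNeg L≥0 (*-nonNeg (≤⇒0≤- L≤f) (+-nonNeg f≥0 L≥0))) (≤⇒0≤- Tx,x))

      -- Not an identity for free `f`: the two sides differ by - L g p times the defect of `root`.
      identity : (f - L) * ⟪ v , v ⟫ + L * (⟪ v , v ⟫ - ⟪ v , ṽ ⟫) + L * ((f - L) * (f + L)) * (a * p - a′)
                 ≈ g ² * (L * (f * p) + f * q - L * (a′ + fromℕ 2 * c + d))
      identity = -≈0⇒≈ (trans
        (+-congʳ (+-congʳ (+-cong (*-congˡ vv) (*-congˡ (+-cong vv (-‿cong vṽ))))))
        (trans
          (solve 8 (λ f L a p q a′ c d →
            let g = f :+ a :* L
                vv = g :* (g :* q :+ L :* :- c) :+ L :* (g :* :- c :+ L :* (a :* (a :* p :+ :- :1 :* a′) :+ :- :1 :* (a :* a′ :+ :- :1 :* p)))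
                vṽ = g :* (g :* d :+ L :* (a :* c)) :+ L :* (g :* (a :* c) :+ L :* (a :* (a :* a′ :+ :- :1 :* p) :+ :- :1 :* (a :* p :+ :- :1 :* a′)))
            in ((f :- L) :* vv :+ L :* (vv :- vṽ) :+ L :* ((f :- L) :* (f :+ L)) :* (a :* p :- a′))
               :- (g :* g) :* (L :* (f :* p) :+ f :* q :- L :* (a′ :+ :2 :* c :+ d))
               := (:- (L :* g :* p)) :* (f :* f :- ((:1 :- L) :* a :* f :+ L)))
            refl f L a p q a′ c d)
          (trans (*-congˡ (≈⇒-≈0 root)) (zeroʳ _))))

      g²>0 : Positive L → Positive (g ²)
      g²>0 L>0 = positive-* g>0 g>0
        where
        g>0 : Positive g
        g>0 = ≤-positive (≤-positive L>0 L≤f)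
          (≤-byDifference (solve 2 (λ f h → (f :+ h) :- f := h) refl f (a * L)) (*-nonNeg a≥0 L≥0))

      -- Here `m` stands for ‖z‖². Adding f (L m - q) ≥ 0 to the certified inequality leaves a
      -- common factor `L` to cancel. If `L ≈ 0#`, then `y` vanishes and `a ≤ f` suffices.
      gram≤ : ∀ {m} → 0# ≤ m → q ≤ L * m → a′ + fromℕ 2 * c + d ≤ f * (p + m)
      gram≤ {m} 0≤m q≤Lm with nonNeg-split L≥0
      ... | inj₂ L>0 = *-cancelˡ-≤ L>0
        (≤-byDifference
          (solve 6 (λ L f p m q e → L :* (f :* (p :+ m)) :- L :* e :=
             (L :* (f :* p) :+ f :* q :- L :* e) :+ f :* (L :* m :- q)) refl L f p m q (a′ + fromℕ 2 * c + d))
          (+-nonNeg (*-cancelˡ-nonNeg (g²>0 L>0) (≤-respʳ identity slack))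
                    (*-nonNeg f≥0 (≤⇒0≤- q≤Lm))))
      ... | inj₁ L≈0 = ≤-trans (≤-reflexive a′+2c+d≈a′) (≤-trans Tx,x
        (≤-byDifference (solve 4 (λ f p m a → f :* (p :+ m) :- a :* p := (f :- a) :* p :+ f :* m) refl f p m a)
          (+-nonNeg (*-nonNeg (≤⇒0≤- a≤f) (⟪⟫-nonNeg x)) (*-nonNeg f≥0 0≤m))))
        where
        y≈0 : ∀ i → y i ≈ 0#
        y≈0 = ⟪⟫-definite (≤-respʳ (trans (*-congʳ L≈0) (zeroˡ m)) q≤Lm)
        a≤f : a ≤ f
        a≤f = ≤-respˡ (trans (*-congʳ (+-congˡ (-‿cong L≈0)))
                (solve 1 (λ a → (:1 :- :0) :* a := a) refl a)) ≤f
        a′+2c+d≈a′ : a′ + fromℕ 2 * c + d ≈ a′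
        a′+2c+d≈a′ = trans
          (+-cong (+-congˡ (*-congˡ (trans (⟪⟫-comm (T x) y) (⟪⟫-zeroˡ (T x) y≈0))))
                  (trans (⟪⟫-comm (T y) y) (⟪⟫-zeroˡ (T y) y≈0)))
          (solve 1 (λ a → a :+ :2 :* :0 :+ :0 := a) refl a′)

      gram≈ : ⟪ (λ i → T x i + T y i) , (λ i → x i + y i) ⟫ ≈ a′ + fromℕ 2 * c + d
      gram≈ = begin
        ⟪ (λ i → T x i + T y i) , (λ i → x i + y i) ⟫
          ≈⟨ ⟪⟫-cong (λ i → sym (+-cong (*-identityˡ _) (*-identityˡ _)))
                     (λ i → sym (+-cong (*-identityˡ _) (*-identityˡ _))) ⟩
        ⟪ 1# ∙ T x + 1# ∙ T y , 1# ∙ x + 1# ∙ y ⟫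
          ≈⟨ ⟪⟫-bilinear 1# (T x) 1# (T y) 1# x 1# y ⟩
        1# * (1# * a′ + 1# * c) + 1# * (1# * ⟪ T y , x ⟫ + 1# * d)
          ≈⟨ +-congˡ (*-congˡ (+-congʳ (*-congˡ (trans (symmetric y x) (⟪⟫-comm y (T x)))))) ⟩
        1# * (1# * a′ + 1# * c) + 1# * (1# * c + 1# * d)
          ≈⟨ solve 3 (λ a c d → :1 :* (:1 :* a :+ :1 :* c) :+ :1 :* (:1 :* c :+ :1 :* d) := a :+ :2 :* c :+ d)
               refl a′ c d ⟩
        a′ + fromℕ 2 * c + d ∎

    reflectionForm≤ : ∀ {x y m} → ⟪ x , y ⟫ ≈ 0# → ⟪ T x , x ⟫ ≤ a * ⟪ x , x ⟫ →
      0# ≤ m → ⟪ y , y ⟫ ≤ L * m →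
      ⟪ (λ i → T x i + T y i) , (λ i → x i + y i) ⟫ ≤ f * (⟪ x , x ⟫ + m)
    reflectionForm≤ {x} {y} x⊥y h 0≤m k = ≤-respˡ (sym gram≈) (gram≤ 0≤m k)
      where
      open Certificate x y x⊥y h

  reflectionForm-bound : ∀ {I} (S : Summation I) {T} → IsReflection S T → let open Summation S in
    ∀ {a L f} → BoundEquation a L f → ∀ {x y m} → ⟪ x , y ⟫ ≈ 0# →
    ⟪ T x , x ⟫ ≤ a * ⟪ x , x ⟫ × - ⟪ T x , x ⟫ ≤ a * ⟪ x , x ⟫ →
    0# ≤ m → ⟪ y , y ⟫ ≤ L * m →
    let t = ⟪ (λ i → T x i + T y i) , (λ i → x i + y i) ⟫ in
    t ≤ f * (⟪ x , x ⟫ + m) × - t ≤ f * (⟪ x , x ⟫ + m)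
  reflectionForm-bound S {T} R B {x} {y} x⊥y (h , h⁻) 0≤m k =
    reflectionForm≤ S R B x⊥y h 0≤m k ,
    ≤-respˡ (trans
        (⟪⟫-cong (λ i → solve 2 (λ x y → :- x :+ :- y := :- (x :+ y)) refl (T x i) (T y i)) (λ _ → refl))
        (⟪⟫-negˡ _ _))
      (reflectionForm≤ S (negate-reflection R) B x⊥y (≤-respˡ (sym (⟪⟫-negˡ _ _)) h⁻) 0≤m k)
    where
    open Summation S

  -- The closed form of the bound as a root of its quadratic equation.

  module _ {l₁ l₂ : Carrier} (0≤l₁ : 0# ≤ l₁) (0≤l₂ : 0# ≤ l₂) (l₂≤1 : l₂ ≤ 1#) where
    open Spectral ℝ using (zigzagBound)
    private
      ½ b e s : Carrier
      ½ = 1# / fromℕ 2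
      b = (1# - l₂ ²) * l₁
      e = (1# - l₂ ²) ² * l₁ ² + fromℕ 4 * l₂ ²
      s = √ e

      2½ : fromℕ 2 * ½ ≈ 1#
      2½ = *-/-cancel 1# (fromℕ 2) (positive⇒≉0 (fromℕ-positive 2))

      e≥0 : 0# ≤ e
      e≥0 = +-nonNeg (*-nonNeg (square-nonNeg _) (square-nonNeg _))
                     (*-nonNeg (fromℕ-nonNeg 4) (square-nonNeg _))

      l₂²≤l₂ : l₂ ² ≤ l₂
      l₂²≤l₂ = ≤-respʳ (*-identityʳ l₂) (*-monoˡ-≤ 0≤l₂ l₂≤1)

      b≥0 : 0# ≤ b
      b≥0 = *-nonNeg (≤⇒0≤- (≤-trans l₂²≤l₂ l₂≤1)) 0≤l₁

      2f : fromℕ 2 * zigzagBound l₁ l₂ ≈ b + s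
      2f = begin
        fromℕ 2 * (½ * (1# - l₂ ²) * l₁ + ½ * s)
          ≈⟨ solve 5 (λ t h m l s → t :* (h :* m :* l :+ h :* s) := (t :* h) :* (m :* l :+ s))
               refl (fromℕ 2) ½ (1# - l₂ ²) l₁ s ⟩
        (fromℕ 2 * ½) * (b + s)   ≈⟨ *-congʳ 2½ ⟩
        1# * (b + s)              ≈⟨ *-identityˡ _ ⟩
        b + s                     ∎

      s²≈b²+4l₂² : s ² ≈ b ² + fromℕ 4 * l₂ ²
      s²≈b²+4l₂² = trans (√-square e≥0)
        (solve 3 (λ m l k → (m :* m) :* (l :* l) :+ k := (m :* l) :* (m :* l) :+ k)
          refl (1# - l₂ ²) l₁ (fromℕ 4 * l₂ ²))

      halve : ∀ {x y} → fromℕ 2 * x ≤ fromℕ 2 * y → x ≤ y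
      halve = *-cancelˡ-≤ (fromℕ-positive 2)

      b≤s : b ≤ s
      b≤s = ≤-fromSquares (√-nonNeg e≥0) (≤-byDifference
        (trans (+-congʳ s²≈b²+4l₂²) (solve 2 (λ b k → (b :* b :+ k) :- b :* b := k) refl b (fromℕ 4 * l₂ ²)))
        (*-nonNeg (fromℕ-nonNeg 4) (square-nonNeg l₂)))

      2l₂≤s : fromℕ 2 * l₂ ≤ s
      2l₂≤s = ≤-fromSquares (√-nonNeg e≥0) (≤-byDifference
        (trans (+-congʳ s²≈b²+4l₂²)
          (solve 2 (λ b l → (b :* b :+ con (+ 4) :* (l :* l)) :- (:2 :* l) :* (:2 :* l) := b :* b) refl b l₂))
        (square-nonNeg b))

    -- Everything is read off 2 f = b + s with s² = b² + 4 l₂². From s ≥ b comes `≤f`; from s ≥ 2 l₂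
    -- comes f ≥ l₂, which dominates l₂² because `l₂ ≤ 1#`; squaring 2 f gives `root`.
    zigzagBound-equation : BoundEquation l₁ (l₂ ²) (zigzagBound l₁ l₂)
    zigzagBound-equation = record
      { a≥0  = 0≤l₁
      ; L≥0  = square-nonNeg l₂
      ; L≤f  = ≤-trans l₂²≤l₂ (halve (≤-respʳ (sym 2f)
                 (≤-byDifference (solve 3 (λ b s l → (b :+ s) :- l := b :+ (s :- l)) refl b s (fromℕ 2 * l₂))
                   (+-nonNeg b≥0 (≤⇒0≤- 2l₂≤s)))))
      ; ≤f   = halve (≤-respʳ (sym 2f)
                 (≤-byDifference (solve 2 (λ b s → (b :+ s) :- :2 :* b := s :- b) refl b s) (≤⇒0≤- b≤s)))
      ; root = *-cancelˡ-≈ (positive⇒≉0 (fromℕ-positive 4)) (begin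
          fromℕ 4 * f ²
            ≈⟨ solve 1 (λ f → con (+ 4) :* (f :* f) := (:2 :* f) :* (:2 :* f)) refl f ⟩
          (fromℕ 2 * f) ²
            ≈⟨ *-cong 2f 2f ⟩
          (b + s) ²
            ≈⟨ solve 2 (λ b s → (b :+ s) :* (b :+ s) := b :* b :+ :2 :* b :* s :+ s :* s) refl b s ⟩
          b ² + fromℕ 2 * b * s + s ²
            ≈⟨ +-congˡ s²≈b²+4l₂² ⟩
          b ² + fromℕ 2 * b * s + (b ² + fromℕ 4 * l₂ ²)
            ≈⟨ solve 3 (λ b s L → b :* b :+ :2 :* b :* s :+ (b :* b :+ con (+ 4) :* L) :=
                                  :2 :* b :* (b :+ s) :+ con (+ 4) :* L) refl b s (l₂ ²) ⟩
          fromℕ 2 * b * (b + s) + fromℕ 4 * l₂ ²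
            ≈⟨ +-congʳ (*-congˡ 2f) ⟨
          fromℕ 2 * b * (fromℕ 2 * f) + fromℕ 4 * l₂ ²
            ≈⟨ solve 3 (λ b f L → :2 :* b :* (:2 :* f) :+ con (+ 4) :* L := con (+ 4) :* (b :* f :+ L))
                 refl b f (l₂ ²) ⟩
          fromℕ 4 * (b * f + l₂ ²) ∎)
      }
      where f = zigzagBound l₁ l₂

-- Finite sums, reindexing and counting.

module FiniteSums (ℝ : RealNumbers) where
  open RealNumbers ℝ
  open OrderedField ℝ
  open InnerProducts ℝ
  open ReflectionForm ℝ
  open import Algebra.Properties.Semiring.Sum semiring
    using (sum-cong-≋; ∑-distrib-+; *-distribˡ-sum; sum-permute; sum-remove)
  open import Algebra.Properties.Semiring.Mult semiring using (×-homo-+)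
  open SetoidReasoning setoid

  sum-zero : ∀ {n} {f : Vector Carrier n} → (∀ i → f i ≈ 0#) → sum f ≈ 0#
  sum-zero {zero}  h = refl
  sum-zero {suc n} h = trans (+-cong (h zero) (sum-zero (λ i → h (suc i)))) (+-identityˡ 0#)

  sum-single : ∀ {n} (f : Vector Carrier n) k → (∀ i → ¬ (i ≡ k) → f i ≈ 0#) → sum f ≈ f k
  sum-single {suc n} f k h = trans (sum-remove {i = k} f)
    (trans (+-congˡ (sum-zero (λ j → h (punchIn k j) (Fin.punchInᵢ≢i k j)))) (+-identityʳ (f k)))

  sum-nonNeg : ∀ {n} {f : Vector Carrier n} → (∀ i → 0# ≤ f i) → 0# ≤ sum f
  sum-nonNeg {zero}  h = ≤-refl
  sum-nonNeg {suc n} h = +-nonNeg (h zero) (sum-nonNeg (λ i → h (suc i)))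

  sum-mono-≤ : ∀ {n} {f g : Vector Carrier n} → (∀ i → f i ≤ g i) → sum f ≤ sum g
  sum-mono-≤ {zero}  h = ≤-refl
  sum-mono-≤ {suc n} h = +-mono-≤ (h zero) (sum-mono-≤ (λ i → h (suc i)))

  +≈0⇒≈0ˡ : ∀ {x y} → 0# ≤ x → 0# ≤ y → x + y ≈ 0# → x ≈ 0#
  +≈0⇒≈0ˡ {x} {y} 0≤x 0≤y eq = antisym
    (≤-byDifference (trans (+-congʳ (sym eq)) (solve 2 (λ x y → (x :+ y) :- x := y) refl x y)) 0≤y) 0≤x

  sum-definite : ∀ {n} {f : Vector Carrier n} → (∀ i → 0# ≤ f i) → sum f ≈ 0# → ∀ i → f i ≈ 0#
  sum-definite h eq zero    = +≈0⇒≈0ˡ (h zero) (sum-nonNeg (λ i → h (suc i))) eq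
  sum-definite h eq (suc i) = sum-definite (λ i → h (suc i))
    (+≈0⇒≈0ˡ (sum-nonNeg (λ i → h (suc i))) (h zero) (trans (+-comm _ _) eq)) i

  sum-+ᵥ : ∀ {m n} (f : Vector Carrier (m +ℕ n)) →
           sum f ≈ sum (λ i → f (i ↑ˡ n)) + sum (λ j → f (m ↑ʳ j))
  sum-+ᵥ {zero}  f = sym (+-identityˡ _)
  sum-+ᵥ {suc m} f = trans (+-congˡ (sum-+ᵥ {m} (f ∘ suc))) (sym (+-assoc _ _ _))

  sum-combine : ∀ {m n} (f : Vector Carrier (m *ℕ n)) →
                sum f ≈ sum (λ (i : Fin m) → sum (λ (j : Fin n) → f (combine i j)))
  sum-combine {zero}      f = refl
  sum-combine {suc m} {n} f = trans (sum-+ᵥ {n} f) (+-congˡ (sum-combine {m} {n} (λ w → f (n ↑ʳ w))))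

  finSum : ∀ n → Summation (Fin n)
  finSum n = record
    { ∑          = sum
    ; ∑-cong     = sum-cong-≋
    ; ∑-+        = ∑-distrib-+
    ; ∑-*        = λ x f → sym (*-distribˡ-sum x f)
    ; ∑-nonNeg   = sum-nonNeg
    ; ∑-definite = sum-definite
    }

  _⊗_ : ∀ {I J} → Summation I → Summation J → Summation (I × J)
  S ⊗ T = record
    { ∑          = λ f → S.∑ λ i → T.∑ λ j → f (i , j)
    ; ∑-cong     = λ h → S.∑-cong λ i → T.∑-cong λ j → h (i , j)
    ; ∑-+        = λ f g → trans (S.∑-cong λ i → T.∑-+ _ _) (S.∑-+ _ _)
    ; ∑-*        = λ x f → trans (S.∑-cong λ i → T.∑-* x _) (S.∑-* x _)
    ; ∑-nonNeg   = λ h → S.∑-nonNeg λ i → T.∑-nonNeg λ j → h (i , j)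
    ; ∑-definite = λ h eq (i , j) → T.∑-definite (λ j → h (i , j))
                     (S.∑-definite (λ i → T.∑-nonNeg λ j → h (i , j)) eq i) j
    }
    where
    module S = Summation S
    module T = Summation T

  pairSum : ∀ m n → Summation (Fin m × Fin n)
  pairSum m n = finSum m ⊗ finSum n

  module _ {m n : ℕ} (π : Fin m × Fin n → Fin m × Fin n) (π-involutive : ∀ p → π (π p) ≡ p) where
    open Summation (pairSum m n)

    private
      π′ : Fin (m *ℕ n) → Fin (m *ℕ n)
      π′ w = uncurry combine (π (remQuot {m} n w))

      π′-involutive : ∀ w → π′ (π′ w) ≡ w
      π′-involutive w = ≡.trans
        (≡.cong (uncurry combine ∘ π) (Fin.remQuot-combine _ _))
        (≡.trans (≡.cong (uncurry combine) (π-involutive _)) (Fin.combine-remQuot {m} n w))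

    -- Flattening pairs along `combine` turns `π` into the permutation `π′` of `Fin (m *ℕ n)`, under
    -- which a single sum is invariant.
    ∑-involution : ∀ f → ∑ (f ∘ π) ≈ ∑ f
    ∑-involution f = begin
      ∑ (f ∘ π)                  ≈⟨ ∑-cong (λ (i , j) → reflexive (≡.cong (f ∘ π) (Fin.remQuot-combine i j))) ⟨
      ∑ (λ (i , j) → f (π (remQuot {m} n (combine i j))))
                                 ≈⟨ sum-combine {m} {n} (f ∘ π ∘ remQuot {m} n) ⟨
      sum (f ∘ π ∘ remQuot {m} n)
                                 ≈⟨ sum-cong-≋ {m *ℕ n} (λ w → reflexive (≡.cong f (Fin.remQuot-combine _ _))) ⟨
      sum (f ∘ remQuot {m} n ∘ π′)
                                 ≈⟨ sum-permute (f ∘ remQuot {m} n) (permutation π′ π′ π′-involutive π′-involutive) ⟨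
      sum (f ∘ remQuot {m} n)    ≈⟨ sum-combine {m} {n} (f ∘ remQuot {m} n) ⟩
      ∑ (λ (i , j) → f (remQuot {m} n (combine i j)))
                                 ≈⟨ ∑-cong (λ (i , j) → reflexive (≡.cong f (Fin.remQuot-combine i j))) ⟩
      ∑ f                        ∎

    ∘-isReflection : IsReflection (pairSum m n) (λ f p → f (π p))
    ∘-isReflection = record
      { isometry  = λ x y → ∑-involution (λ p → x p * y p)
      ; symmetric = λ x y → trans
          (∑-cong (λ p → *-congˡ (reflexive (≡.cong y (≡.sym (π-involutive p))))))
          (∑-involution (λ p → x p * y (π p)))
      }

  -- Branching on `does` makes it reduce in step with `filter`.
  indicator : ∀ {P : Set} → Dec P → Carrier
  indicator P? = if does P? then 1# else 0#

  fromℕ-+ : ∀ m n → fromℕ (m +ℕ n) ≈ fromℕ m + fromℕ n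
  fromℕ-+ = ×-homo-+ 1#

  length-filter-tabulate : ∀ {A : Set} {P : A → Set} (P? : Decidable P) {n} (h : Fin n → A) →
    fromℕ (length (filter P? (tabulate h))) ≈ sum (λ j → indicator (P? (h j)))
  length-filter-tabulate P? {zero}  h = refl
  length-filter-tabulate P? {suc n} h with does (P? (h zero))
  ... | true  = +-congˡ (length-filter-tabulate P? (h ∘ suc))
  ... | false = trans (length-filter-tabulate P? (h ∘ suc)) (sym (+-identityˡ _))

  length-filter-cartesianProduct :
    ∀ {A B : Set} {P : A × B → Set} (P? : Decidable P) {m n} (f : Fin m → A) (g : Fin n → B) →
    fromℕ (length (filter P? (cartesianProduct (tabulate f) (tabulate g)))) ≈
    sum (λ i → sum (λ j → indicator (P? (f i , g j))))
  length-filter-cartesianProduct P? {zero}  f g = refl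
  length-filter-cartesianProduct P? {suc m} f g = begin
    fromℕ (length (filter P? (row ++ rest)))
      ≡⟨ ≡.cong (fromℕ ∘ length) (List.filter-++ P? row rest) ⟩
    fromℕ (length (filter P? row ++ filter P? rest))
      ≡⟨ ≡.cong fromℕ (List.length-++ (filter P? row)) ⟩
    fromℕ (length (filter P? row) +ℕ length (filter P? rest))
      ≈⟨ fromℕ-+ (length (filter P? row)) _ ⟩
    fromℕ (length (filter P? row)) + fromℕ (length (filter P? rest))
      ≡⟨ ≡.cong (λ xs → fromℕ (length (filter P? xs)) + fromℕ (length (filter P? rest)))
           (List.map-tabulate g (f zero ,_)) ⟩
    fromℕ (length (filter P? (tabulate (λ j → f zero , g j)))) + fromℕ (length (filter P? rest))
      ≈⟨ +-cong (length-filter-tabulate P? (λ j → f zero , g j)) (length-filter-cartesianProduct P? (f ∘ suc) g) ⟩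
    sum (λ i → sum (λ j → indicator (P? (f i , g j)))) ∎
    where
    row  = List.map (f zero ,_) (tabulate g)
    rest = cartesianProduct (tabulate (f ∘ suc)) (tabulate g)

-- The adjacency operator and equivalent forms of the spectral bound.

module GraphOperator (ℝ : RealNumbers) where
  open Spectral ℝ
  open OrderedField ℝ
  open InnerProducts ℝ
  open ReflectionForm ℝ
  open FiniteSums ℝ
  open import Algebra.Properties.Semiring.Sum semiring
    using (sum-cong-≋; *-distribˡ-sum; *-distribʳ-sum; sum-replicate; ∑-comm)
  open import Algebra.Properties.Semiring.Mult semiring using (×-assoc-*; ×-congʳ)
  open SetoidReasoning setoid

  module _ {N D : ℕ} .{{_ : NonZero D}} (G : Graph (Fin N) (Fin D)) where
    private
      module V = Summation (finSum N)
      module E = Summation (pairSum N D)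

      M : Vector Carrier N → Vector Carrier N
      M α = adjacency G $ᵥ α

      D≉0 : ¬ (fromℕ D ≈ 0#)
      D≉0 = positive⇒≉0 (fromℕ-positive D)

    -- Trades edge counts for the rotation map: for fixed `i`, exactly one pair `(v , j)` equals
    -- `rot G (u , i)`, so the indicators collapse to one term. The factor `fromℕ D` clears the
    -- normalization.
    degree-* : ∀ α u → fromℕ D * (adjacency G $ᵥ α) u ≈ sum (λ i → α (proj₁ (rot G (u , i))))
    degree-* α u = begin
      fromℕ D * sum (λ v → adjacency G u v * α v)
        ≈⟨ *-distribˡ-sum (fromℕ D) (λ v → adjacency G u v * α v) ⟩
      sum (λ v → fromℕ D * (adjacency G u v * α v))
        ≈⟨ sum-cong-≋ {N} (λ v → trans (sym (*-assoc _ _ _)) (*-congʳ (*-/-cancel _ (fromℕ D) D≉0))) ⟩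
      sum (λ v → fromℕ (multiplicity G u v) * α v)
        ≈⟨ sum-cong-≋ {N} (λ v → *-congʳ (length-filter-cartesianProduct (λ (i , j) → ≡-dec Fin._≟_ Fin._≟_ (rot G (u , i)) (v , j)) {D} {D} id id)) ⟩
      sum (λ v → sum (λ i → sum (λ j → [ i , v , j ])) * α v)
        ≈⟨ sum-cong-≋ (λ v → *-distribʳ-sum (α v) (λ i → sum (λ j → [ i , v , j ]))) ⟩
      sum (λ v → sum (λ i → sum (λ j → [ i , v , j ]) * α v))
        ≈⟨ ∑-comm (λ v i → sum (λ j → [ i , v , j ]) * α v) ⟩
      sum (λ i → sum (λ v → sum (λ j → [ i , v , j ]) * α v))
        ≈⟨ sum-cong-≋ neighbour ⟩
      sum (λ i → α (proj₁ (rot G (u , i)))) ∎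
      where
      [_,_,_] : Fin D → Fin N → Fin D → Carrier
      [ i , v , j ] = indicator (≡-dec Fin._≟_ Fin._≟_ (rot G (u , i)) (v , j))

      indicator-no : ∀ i v j → ¬ (rot G (u , i) ≡ (v , j)) → [ i , v , j ] ≈ 0#
      indicator-no i v j ≢ with ≡-dec Fin._≟_ Fin._≟_ (rot G (u , i)) (v , j)
      ... | yes eq = contradiction eq ≢
      ... | no  _  = refl

      indicator-yes : ∀ i v j → rot G (u , i) ≡ (v , j) → [ i , v , j ] ≈ 1#
      indicator-yes i v j eq with ≡-dec Fin._≟_ Fin._≟_ (rot G (u , i)) (v , j)
      ... | yes _ = refl
      ... | no  ≢ = contradiction eq ≢

      neighbour : ∀ i → sum (λ v → sum (λ j → [ i , v , j ]) * α v) ≈ α (proj₁ (rot G (u , i)))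
      neighbour i = begin
        sum (λ v → sum (λ j → [ i , v , j ]) * α v)
          ≈⟨ sum-single _ w (λ v v≢w → trans
               (*-congʳ (sum-zero (λ j → indicator-no i v j (λ eq → v≢w (≡.sym (≡.cong proj₁ eq))))))
               (zeroˡ (α v))) ⟩
        sum (λ j → [ i , w , j ]) * α w
          ≈⟨ *-congʳ (trans
               (sum-single _ k (λ j j≢k → indicator-no i w j (λ eq → j≢k (≡.sym (≡.cong proj₂ eq)))))
               (indicator-yes i w k ≡.refl)) ⟩
        1# * α w ≈⟨ *-identityˡ (α w) ⟩
        α w      ∎
        where
        w = proj₁ (rot G (u , i))
        k = proj₂ (rot G (u , i))

    lift : Vector Carrier N → Fin N × Fin D → Carrier
    lift α (u , i) = α u

    private
      T : (Fin N × Fin D → Carrier) → Fin N × Fin D → Carrier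
      T f p = f (rot G p)

    rot-isReflection : IsReflection (pairSum N D) (λ f p → f (rot G p))
    rot-isReflection = ∘-isReflection (rot G) (rot-involutive G)

    sum-const : ∀ x → sum {D} (λ _ → x) ≈ fromℕ D * x
    sum-const x = trans (sum-replicate D)
      (trans (×-congʳ D (sym (*-identityˡ x))) (sym (×-assoc-* D 1# x)))

    ∑-lift : ∀ α → E.∑ (lift α) ≈ fromℕ D * sum α
    ∑-lift α = trans (sum-cong-≋ (λ u → sum-const (α u))) (sym (*-distribˡ-sum (fromℕ D) α))

    lift-isometry : ∀ α β → E.⟪ lift α , lift β ⟫ ≈ fromℕ D * ⟨ α , β ⟩
    lift-isometry α β = ∑-lift (λ u → α u * β u)

    -- The adjacency operator is the compression of the permutation `rot G` of edge ends to
    -- functions constant on each cloud. Its symmetry and the bound 1 are inherited from that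
    -- permutation.
    rot-form : ∀ α β → E.⟪ T (lift α) , lift β ⟫ ≈ fromℕ D * ⟨ M α , β ⟩
    rot-form α β = begin
      sum (λ u → sum (λ i → α (proj₁ (rot G (u , i))) * β u))
        ≈⟨ sum-cong-≋ (λ u → *-distribʳ-sum (β u) (λ i → α (proj₁ (rot G (u , i))))) ⟨
      sum (λ u → sum (λ i → α (proj₁ (rot G (u , i)))) * β u)
        ≈⟨ sum-cong-≋ (λ u → *-congʳ (degree-* α u)) ⟨
      sum (λ u → (fromℕ D * M α u) * β u)
        ≈⟨ sum-cong-≋ {N} (λ u → *-assoc _ _ _) ⟩
      sum (λ u → fromℕ D * (M α u * β u))
        ≈⟨ *-distribˡ-sum (fromℕ D) (λ u → M α u * β u) ⟨
      fromℕ D * ⟨ M α , β ⟩ ∎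

    $ᵥ-symmetric : ∀ α β → ⟨ adjacency G $ᵥ α , β ⟩ ≈ ⟨ α , adjacency G $ᵥ β ⟩
    $ᵥ-symmetric α β = *-cancelˡ-≈ D≉0 (begin
      fromℕ D * ⟨ M α , β ⟩         ≈⟨ rot-form α β ⟨
      E.⟪ T (lift α) , lift β ⟫     ≈⟨ IsReflection.symmetric rot-isReflection _ _ ⟩
      E.⟪ lift α , T (lift β) ⟫     ≈⟨ E.⟪⟫-comm (lift α) (T (lift β)) ⟩
      E.⟪ T (lift β) , lift α ⟫     ≈⟨ rot-form β α ⟩
      fromℕ D * ⟨ M β , α ⟩         ≈⟨ *-congˡ (V.⟪⟫-comm (M β) α) ⟩
      fromℕ D * ⟨ α , M β ⟩         ∎)

    $ᵥ-linear : ∀ s α t β u → (adjacency G $ᵥ (s V.∙ α + t ∙ β)) u ≈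
                (s V.∙ (adjacency G $ᵥ α) + t ∙ (adjacency G $ᵥ β)) u
    $ᵥ-linear s α t β u = V.⟪⟫-linearʳ s α t β (adjacency G u)

    sum-$ᵥ : ∀ α → sum (adjacency G $ᵥ α) ≈ sum α
    sum-$ᵥ α = *-cancelˡ-≈ D≉0 (begin
      fromℕ D * sum (M α)                                 ≈⟨ *-distribˡ-sum (fromℕ D) (M α) ⟩
      sum (λ u → fromℕ D * M α u)                         ≈⟨ sum-cong-≋ (degree-* α) ⟩
      E.∑ (T (lift α))                                    ≈⟨ ∑-involution (rot G) (rot-involutive G) (lift α) ⟩
      E.∑ (lift α)                                        ≈⟨ ∑-lift α ⟩
      fromℕ D * sum α                                     ∎)

    $ᵥ-const : ∀ x u → (adjacency G $ᵥ (λ _ → x)) u ≈ x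
    $ᵥ-const x u = *-cancelˡ-≈ D≉0 (trans (degree-* (λ _ → x) u) (sum-const x))

    $ᵥ-zero : ∀ {α} → IsZero α → IsZero (adjacency G $ᵥ α)
    $ᵥ-zero {α} α≈0 u = trans (V.⟪⟫-comm (adjacency G u) α) (V.⟪⟫-zeroˡ (adjacency G u) α≈0)

    FormBound : Carrier → Set
    FormBound μ = ∀ α → sum α ≈ 0# →
      ⟨ adjacency G $ᵥ α , α ⟩ ≤ μ * ⟨ α , α ⟩ × - ⟨ adjacency G $ᵥ α , α ⟩ ≤ μ * ⟨ α , α ⟩

    -- The eigenvalue bound with quotient, roots and supremum cleared; it also makes sense for the
    -- zero vector and for a single vertex.
    NormBound : Carrier → Set
    NormBound μ = ∀ α → sum α ≈ 0# →
      ⟨ adjacency G $ᵥ α , adjacency G $ᵥ α ⟩ ≤ μ ² * ⟨ α , α ⟩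

    formBound⇒normBound : ∀ {μ} → 0# ≤ μ → FormBound μ → NormBound μ
    formBound⇒normBound {μ} 0≤μ = V.normFromForm (λ α → sum α ≈ 0#) M μ 0≤μ
      (λ s α t β ∑α≈0 ∑β≈0 → trans (V.∑-linear s α t β)
        (trans (+-cong (trans (*-congˡ ∑α≈0) (zeroʳ s)) (trans (*-congˡ ∑β≈0) (zeroʳ t))) (+-identityˡ 0#)))
      (λ α ∑α≈0 → trans (sum-$ᵥ α) ∑α≈0)
      $ᵥ-linear $ᵥ-symmetric

    normBound⇒formBound : ∀ {μ} → 0# ≤ μ → NormBound μ → FormBound μ
    normBound⇒formBound 0≤μ bound α ∑α≈0 = V.cauchySchwarz± α (M α) 0≤μ (bound α ∑α≈0)

    -- Supplies the boundedness without which `sup` says nothing about the stretch factors. On edge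
    -- ends `rot G` is an isometry, so Cauchy-Schwarz bounds its form by 1, and the compression
    -- inherits this.
    normBound-1 : NormBound 1#
    normBound-1 = formBound⇒normBound 0≤1 (λ α _ →
      let (upper , lower) = E.cauchySchwarz± (lift α) (T (lift α)) 0≤1
            (≤-reflexive (trans (IsReflection.isometry rot-isReflection _ _)
              (solve 1 (λ x → x := (:1 :* :1) :* x) refl _)))
          form = rot-form α α
          norm = trans (*-congˡ (lift-isometry α α))
                   (solve 2 (λ d x → :1 :* (d :* x) := d :* (:1 :* x)) refl (fromℕ D) ⟨ α , α ⟩)
      in *-cancelˡ-≤ (fromℕ-positive D) (≤-respˡ form (≤-respʳ norm upper))
       , *-cancelˡ-≤ (fromℕ-positive D) (≤-respˡ
           (trans (-‿cong form) (solve 2 (λ d x → :- (d :* x) := d :* :- x) refl (fromℕ D) ⟨ M α , α ⟩))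
           (≤-respʳ norm lower)))

    private
      ‖‖²≈ : ∀ (α : Vector Carrier N) → ‖ α ‖ ² ≈ ⟨ α , α ⟩
      ‖‖²≈ α = √-square (V.⟪⟫-nonNeg α)

      ‖‖-positive : ∀ {α : Vector Carrier N} → ¬ IsZero α → Positive ‖ α ‖
      ‖‖-positive {α} α≉0 ‖α‖≤0 = α≉0 (V.⟪⟫-definite (≤-reflexive
        (trans (sym (‖‖²≈ α)) (trans (*-congʳ ‖α‖≈0) (zeroˡ _)))))
        where
        ‖α‖≈0 : ‖ α ‖ ≈ 0#
        ‖α‖≈0 = antisym ‖α‖≤0 (√-nonNeg (V.⟪⟫-nonNeg α))

      [‖α‖μ]² : ∀ α μ → (‖ α ‖ * μ) ² ≈ μ ² * ⟨ α , α ⟩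
      [‖α‖μ]² α μ = trans (solve 2 (λ a m → (a :* m) :* (a :* m) := (m :* m) :* (a :* a)) refl ‖ α ‖ μ)
                      (*-congˡ (‖‖²≈ α))

    normBound⇒upperBound : ∀ {μ} → 0# ≤ μ → NormBound μ → IsUpperBound (StretchFactor G) μ
    normBound⇒upperBound {μ} 0≤μ bound r (α , α⊥𝟏 , α≉0 , r≈) =
      *-cancelˡ-≤ (‖‖-positive α≉0) (≤-respˡ
        (sym (trans (*-congˡ r≈) (*-/-cancel _ ‖ α ‖ (positive⇒≉0 (‖‖-positive α≉0)))))
        (≤-fromSquares (*-nonNeg (√-nonNeg (V.⟪⟫-nonNeg α)) 0≤μ)
          (≤-respˡ (sym (‖‖²≈ (M α))) (≤-respʳ (sym ([‖α‖μ]² α μ))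
            (bound α (trans (sum-cong-≋ (λ v → sym (*-identityʳ (α v)))) α⊥𝟏))))))

    upperBound⇒normBound : ∀ {μ} → 0# ≤ μ → IsUpperBound (StretchFactor G) μ → NormBound μ
    upperBound⇒normBound {μ} 0≤μ bound α ∑α≈0 with ⟨ α , α ⟩ ≤? 0#
    -- The zero vector has no stretch factor, so it is treated directly.
    ... | yes ⟨α,α⟩≤0 = ≤-respˡ
      (sym (V.⟪⟫-zeroˡ (M α) ($ᵥ-zero (V.⟪⟫-definite ⟨α,α⟩≤0))))
      (*-nonNeg (square-nonNeg μ) (V.⟪⟫-nonNeg α))
    ... | no ⟨α,α⟩>0 = ≤-respˡ (‖‖²≈ (M α)) (≤-respʳ ([‖α‖μ]² α μ)
      (*-mono-≤ ‖Mα‖≥0 ‖Mα‖≥0 ‖Mα‖≤ ‖Mα‖≤))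
      where
      α≉0 : ¬ IsZero α
      α≉0 α≈0 = ⟨α,α⟩>0 (≤-reflexive (V.⟪⟫-zeroˡ α α≈0))
      ‖Mα‖≥0 : 0# ≤ ‖ M α ‖
      ‖Mα‖≥0 = √-nonNeg (V.⟪⟫-nonNeg (M α))
      ‖Mα‖≤ : ‖ M α ‖ ≤ ‖ α ‖ * μ
      ‖Mα‖≤ = ≤-respˡ (*-/-cancel _ ‖ α ‖ (positive⇒≉0 (‖‖-positive α≉0)))
        (*-monoˡ-≤ (positive⇒nonNeg (‖‖-positive α≉0))
          (bound _ (α , trans (sum-cong-≋ (λ v → *-identityʳ (α v))) ∑α≈0 , α≉0 , refl)))

  -- Nonemptiness, the other condition on `sup`. The witness is the difference of two basis vectors,
  -- hence the two vertices.
  stretchFactor-exists : ∀ {n D} (G : Graph (Fin (suc (suc n))) (Fin D)) → ∃ (StretchFactor G)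
  stretchFactor-exists {n} G = _ , α , α⊥𝟏 , (λ α≈0 → 0≉1 (sym (α≈0 zero))) , refl
    where
    α : Vector Carrier _
    α zero          = 1#
    α (suc zero)    = - 1#
    α (suc (suc _)) = 0#
    α⊥𝟏 : ⟨ α , 𝟏 ⟩ ≈ 0#
    α⊥𝟏 = trans (+-congˡ (+-congˡ (sum-zero {n} (λ _ → zeroˡ 1#))))
      (solve 0 (:1 :* :1 :+ (:- :1 :* :1 :+ :0) := :0) refl)

  -- With one vertex the eigenvalue is 0 by convention and carries no information, but a vector with
  -- zero sum is then zero.
  spectral⇒normBound : ∀ {N D} .{{_ : NonZero N}} .{{_ : NonZero D}} (G : Graph (Fin N) (Fin D)) {μ} →
    0# ≤ μ → IsSpectralGraph N D μ G → NormBound G μ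
  spectral⇒normBound {1} G {μ} 0≤μ _ α ∑α≈0 = ≤-respˡ
    (sym (⟪⟫-zeroˡ (adjacency G $ᵥ α) ($ᵥ-zero G α≈0)))
    (*-nonNeg (square-nonNeg μ) (⟪⟫-nonNeg α))
    where
    open Summation (finSum 1)
    α≈0 : IsZero α
    α≈0 zero = trans (sym (+-identityʳ (α zero))) ∑α≈0
  spectral⇒normBound {suc (suc n)} G 0≤μ λG≤μ = upperBound⇒normBound G 0≤μ
    (λ r r∈ → ≤-trans (proj₁ isLUB r r∈) λG≤μ)
    where
    isLUB : IsLeastUpperBound (StretchFactor G) (secondEigenvalue G)
    isLUB = sup-isLUB _ (stretchFactor-exists G) (1# , normBound⇒upperBound G 0≤1 (normBound-1 G))

  normBound⇒spectral : ∀ {N D} .{{_ : NonZero N}} .{{_ : NonZero D}} (G : Graph (Fin N) (Fin D)) {μ} →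
    0# ≤ μ → NormBound G μ → IsSpectralGraph N D μ G
  normBound⇒spectral {1}           G 0≤μ _     = 0≤μ
  normBound⇒spectral {suc (suc n)} G {μ} 0≤μ bound = proj₂
    (sup-isLUB _ (stretchFactor-exists G) (μ , upperBound)) μ upperBound
    where
    upperBound : IsUpperBound (StretchFactor G) μ
    upperBound = normBound⇒upperBound G 0≤μ bound

-- The zig-zag operator and its decomposition over clouds.

module ZigzagOperator (ℝ : RealNumbers) where
  open Spectral ℝ
  open OrderedField ℝ
  open InnerProducts ℝ
  open ReflectionForm ℝ
  open FiniteSums ℝ
  open GraphOperator ℝ
  open import Algebra.Properties.Semiring.Sum semiring using (sum-cong-≋; *-distribˡ-sum)
  open import Algebra.Properties.Semiring.Mult semiring using (×1-homo-*)
  open SetoidReasoning setoid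

  module _ {N₁ D₁ D₂ : ℕ} .{{_ : NonZero N₁}} .{{_ : NonZero D₁}} .{{_ : NonZero D₂}}
           (G₁ : Graph (Fin N₁) (Fin D₁)) (G₂ : Graph (Fin D₁) (Fin D₂)) where
    open Summation (pairSum N₁ D₁)
    private
      module K = Summation (finSum D₁)
      M₂ : Vector Carrier D₁ → Vector Carrier D₁
      M₂ α = adjacency G₂ $ᵥ α

      instance
        D₂D₂-nonZero : NonZero (D₂ *ℕ D₂)
        D₂D₂-nonZero = ℕ.m*n≢0 D₂ D₂
        N₁D₁-nonZero : NonZero (N₁ *ℕ D₁)
        N₁D₁-nonZero = ℕ.m*n≢0 N₁ D₁

    Z : Graph (Fin (N₁ *ℕ D₁)) (Fin (D₂ *ℕ D₂))
    Z = relabel *↔× *↔× (zigzag G₁ G₂)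

    A B : (Fin N₁ × Fin D₁ → Carrier) → Fin N₁ × Fin D₁ → Carrier
    A f p       = f (rot G₁ p)
    B f (v , k) = M₂ (λ k′ → f (v , k′)) k

    clouds : Vector Carrier (N₁ *ℕ D₁) → Fin N₁ × Fin D₁ → Carrier
    clouds α (v , k) = α (combine v k)

    B-symmetric : ∀ f g → ⟪ B f , g ⟫ ≈ ⟪ f , B g ⟫
    B-symmetric f g = sum-cong-≋ (λ v → $ᵥ-symmetric G₂ (λ k → f (v , k)) (λ k → g (v , k)))

    -- With denominators cleared, the left side sums over label pairs `(i , j)`. Summing over `j`
    -- first yields the inner `B` at the point reached through `rot G₁`, and summing over `i` yields
    -- the outer one; the returned labels do not affect the endpoint.
    zigzag-$ᵥ : ∀ α p → clouds (adjacency Z $ᵥ α) p ≈ B (A (B (clouds α))) p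
    zigzag-$ᵥ α (v , k) = *-cancelˡ-≈ (positive⇒≉0 (fromℕ-positive (D₂ *ℕ D₂))) (begin
      fromℕ (D₂ *ℕ D₂) * (adjacency Z $ᵥ α) (combine v k)
        ≈⟨ degree-* Z α (combine v k) ⟩
      sum (λ t → α (proj₁ (rot Z (combine v k , t))))
        ≈⟨ sum-combine {D₂} {D₂} _ ⟩
      sum (λ (i : Fin D₂) → sum (λ (j : Fin D₂) → α (proj₁ (rot Z (combine v k , combine i j)))))
        ≈⟨ sum-cong-≋ (λ i → sum-cong-≋ {D₂} (λ j → reflexive (≡.cong₂
             (λ p q → clouds α (proj₁ (rot (zigzag G₁ G₂) (p , q))))
             (Fin.remQuot-combine v k) (Fin.remQuot-combine i j)))) ⟩
      sum (λ i → sum (λ j → clouds α (w i , proj₁ (rot G₂ (ℓ′ i , j)))))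
        ≈⟨ sum-cong-≋ (λ i → degree-* G₂ (λ ℓ → clouds α (w i , ℓ)) (ℓ′ i)) ⟨
      sum (λ i → fromℕ D₂ * A (B (clouds α)) (v , k′ i))
        ≈⟨ *-distribˡ-sum (fromℕ D₂) (λ i → A (B (clouds α)) (v , k′ i)) ⟨
      fromℕ D₂ * sum (λ i → A (B (clouds α)) (v , k′ i))
        ≈⟨ *-congˡ (degree-* G₂ (λ k′ → A (B (clouds α)) (v , k′)) k) ⟨
      fromℕ D₂ * (fromℕ D₂ * B (A (B (clouds α))) (v , k))
        ≈⟨ *-assoc _ _ _ ⟨
      (fromℕ D₂ * fromℕ D₂) * B (A (B (clouds α))) (v , k)
        ≈⟨ *-congʳ (×1-homo-* D₂ D₂) ⟨
      fromℕ (D₂ *ℕ D₂) * B (A (B (clouds α))) (v , k) ∎)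
      where
      k′ : Fin D₂ → Fin D₁
      k′ i = proj₁ (rot G₂ (k , i))
      w : Fin D₂ → Fin N₁
      w i = proj₁ (rot G₁ (v , k′ i))
      ℓ′ : Fin D₂ → Fin D₁
      ℓ′ i = proj₂ (rot G₁ (v , k′ i))

    clouds-isometry : ∀ α β → ⟨ α , β ⟩ ≈ ⟪ clouds α , clouds β ⟫
    clouds-isometry α β = sum-combine {N₁} {D₁} (λ w → α w * β w)

    zigzag-form : ∀ α → ⟨ adjacency Z $ᵥ α , α ⟩ ≈ ⟪ A (B (clouds α)) , B (clouds α) ⟫
    zigzag-form α = begin
      ⟨ adjacency Z $ᵥ α , α ⟩                       ≈⟨ clouds-isometry (adjacency Z $ᵥ α) α ⟩
      ⟪ clouds (adjacency Z $ᵥ α) , clouds α ⟫       ≈⟨ ⟪⟫-cong (zigzag-$ᵥ α) (λ _ → refl) ⟩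
      ⟪ B (A (B (clouds α))) , clouds α ⟫            ≈⟨ B-symmetric (A (B (clouds α))) (clouds α) ⟩
      ⟪ A (B (clouds α)) , B (clouds α) ⟫            ∎

    lift-⊥ : ∀ ξ f → (∀ v → sum (λ k → f (v , k)) ≈ 0#) → ⟪ lift G₁ ξ , f ⟫ ≈ 0#
    lift-⊥ ξ f f-balanced = sum-zero (λ v → trans
      (sym (*-distribˡ-sum (ξ v) (λ k → f (v , k))))
      (trans (*-congˡ (f-balanced v)) (zeroʳ (ξ v))))

    module Decomposition (b : Fin N₁ × Fin D₁ → Carrier) where
      D₁≉0 : ¬ (fromℕ D₁ ≈ 0#)
      D₁≉0 = positive⇒≉0 (fromℕ-positive D₁)

      ξ : Vector Carrier N₁
      ξ v = sum (λ k → b (v , k)) / fromℕ D₁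

      D₁ξ : ∀ v → fromℕ D₁ * ξ v ≈ sum (λ k → b (v , k))
      D₁ξ v = *-/-cancel _ (fromℕ D₁) D₁≉0

      x z y : Fin N₁ × Fin D₁ → Carrier
      x = lift G₁ ξ
      z = 1# ∙ b + - 1# ∙ x
      y = B z

      b≈x+z : ∀ p → b p ≈ (1# ∙ x + 1# ∙ z) p
      b≈x+z p = solve 2 (λ b x → b := :1 :* x :+ :1 :* (:1 :* b :+ :- :1 :* x)) refl (b p) (x p)

      z-balanced : ∀ v → sum (λ k → z (v , k)) ≈ 0#
      z-balanced v = begin
        sum (λ k → z (v , k))
          ≈⟨ K.∑-linear 1# (λ k → b (v , k)) (- 1#) (λ _ → ξ v) ⟩
        1# * sum (λ k → b (v , k)) + - 1# * sum {D₁} (λ _ → ξ v)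
          ≈⟨ +-cong (*-congˡ (sym (D₁ξ v))) (*-congˡ (sum-const G₁ (ξ v))) ⟩
        1# * (fromℕ D₁ * ξ v) + - 1# * (fromℕ D₁ * ξ v)
          ≈⟨ solve 1 (λ x → :1 :* x :+ :- :1 :* x := :0) refl (fromℕ D₁ * ξ v) ⟩
        0# ∎

      y-balanced : ∀ v → sum (λ k → y (v , k)) ≈ 0#
      y-balanced v = trans (sum-$ᵥ G₂ (λ k → z (v , k))) (z-balanced v)

      -- `B` fixes functions constant on clouds, because the normalized adjacency matrix of `G₂` has
      -- row sums 1.
      Bb≈x+y : ∀ p → B b p ≈ x p + y p
      Bb≈x+y (v , k) = begin
        B b (v , k)
          ≈⟨ K.⟪⟫-cong {x = adjacency G₂ k} (λ _ → refl) (λ k′ → b≈x+z (v , k′)) ⟩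
        M₂ (1# K.∙ (λ _ → ξ v) + 1# ∙ (λ k′ → z (v , k′))) k
          ≈⟨ $ᵥ-linear G₂ 1# (λ _ → ξ v) 1# (λ k′ → z (v , k′)) k ⟩
        1# * M₂ (λ _ → ξ v) k + 1# * y (v , k)
          ≈⟨ +-cong (trans (*-identityˡ _) ($ᵥ-const G₂ (ξ v) k)) (*-identityˡ _) ⟩
        ξ v + y (v , k) ∎

      x⊥y : ⟪ x , y ⟫ ≈ 0#
      x⊥y = lift-⊥ ξ y y-balanced

      pythagoras : ⟪ b , b ⟫ ≈ ⟪ x , x ⟫ + ⟪ z , z ⟫
      pythagoras = begin
        ⟪ b , b ⟫
          ≈⟨ ⟪⟫-cong b≈x+z b≈x+z ⟩
        ⟪ 1# ∙ x + 1# ∙ z , 1# ∙ x + 1# ∙ z ⟫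
          ≈⟨ ⟪⟫-bilinear 1# x 1# z 1# x 1# z ⟩
        1# * (1# * ⟪ x , x ⟫ + 1# * ⟪ x , z ⟫) + 1# * (1# * ⟪ z , x ⟫ + 1# * ⟪ z , z ⟫)
          ≈⟨ +-cong (*-congˡ (+-congˡ (*-congˡ x⊥z)))
                    (*-congˡ (+-congʳ (*-congˡ (trans (⟪⟫-comm z x) x⊥z)))) ⟩
        1# * (1# * ⟪ x , x ⟫ + 1# * 0#) + 1# * (1# * 0# + 1# * ⟪ z , z ⟫)
          ≈⟨ solve 2 (λ x z → :1 :* (:1 :* x :+ :1 :* :0) :+ :1 :* (:1 :* :0 :+ :1 :* z) := x :+ z)
               refl ⟪ x , x ⟫ ⟪ z , z ⟫ ⟩
        ⟪ x , x ⟫ + ⟪ z , z ⟫ ∎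
        where
        x⊥z : ⟪ x , z ⟫ ≈ 0#
        x⊥z = lift-⊥ ξ z z-balanced

      -- `z` has zero sum in every cloud, so the bound for `G₂` applies cloud by cloud and the
      -- results add up.
      y≤ : ∀ {l₂} → NormBound G₂ l₂ → ⟪ y , y ⟫ ≤ l₂ ² * ⟪ z , z ⟫
      y≤ {l₂} bound₂ = ≤-respʳ
        (sym (*-distribˡ-sum (l₂ ²) (λ v → ⟨ (λ k → z (v , k)) , (λ k → z (v , k)) ⟩)))
        (sum-mono-≤ (λ v → bound₂ (λ k → z (v , k)) (z-balanced v)))

      -- On lifted vectors the form of `A` is `fromℕ D₁` times that of the adjacency operator of
      -- `G₁`, and squared norms scale by the same factor. The zero sum of `b` is what makes `ξ`
      -- orthogonal to 𝟏.
      Ax,x : ∀ {l₁} → FormBound G₁ l₁ → ∑ b ≈ 0# →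
             ⟪ A x , x ⟫ ≤ l₁ * ⟪ x , x ⟫ × - ⟪ A x , x ⟫ ≤ l₁ * ⟪ x , x ⟫
      Ax,x {l₁} bound₁ ∑b≈0 =
        ≤-respˡ (sym (rot-form G₁ ξ ξ)) (≤-respʳ norm (*-monoˡ-≤ D₁≥0 (proj₁ bound))) ,
        ≤-respˡ (trans (solve 2 (λ d e → d :* :- e := :- (d :* e)) refl (fromℕ D₁) ⟨ adjacency G₁ $ᵥ ξ , ξ ⟩)
                   (-‿cong (sym (rot-form G₁ ξ ξ))))
          (≤-respʳ norm (*-monoˡ-≤ D₁≥0 (proj₂ bound)))
        where
        D₁≥0 : 0# ≤ fromℕ D₁
        D₁≥0 = fromℕ-nonNeg D₁
        sum-ξ : sum ξ ≈ 0#
        sum-ξ = *-cancelˡ-≈0 D₁≉0 (trans (*-distribˡ-sum (fromℕ D₁) ξ)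
                  (trans (sum-cong-≋ D₁ξ) ∑b≈0))
        bound : ⟨ adjacency G₁ $ᵥ ξ , ξ ⟩ ≤ l₁ * ⟨ ξ , ξ ⟩ × - ⟨ adjacency G₁ $ᵥ ξ , ξ ⟩ ≤ l₁ * ⟨ ξ , ξ ⟩
        bound = bound₁ ξ sum-ξ
        norm : fromℕ D₁ * (l₁ * ⟨ ξ , ξ ⟩) ≈ l₁ * ⟪ x , x ⟫
        norm = trans (solve 3 (λ d l e → d :* (l :* e) := l :* (d :* e)) refl (fromℕ D₁) l₁ ⟨ ξ , ξ ⟩)
                 (*-congˡ (sym (lift-isometry G₁ ξ ξ)))

    zigzag-formBound : ∀ {l₁ l₂ f} → BoundEquation l₁ (l₂ ²) f →
      FormBound G₁ l₁ → NormBound G₂ l₂ → FormBound Z f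
    zigzag-formBound {l₁} {l₂} {f} eq bound₁ bound₂ α ∑α≈0 =
      ≤-respˡ (sym form) (≤-respʳ norm (proj₁ bound)) ,
      ≤-respˡ (-‿cong (sym form)) (≤-respʳ norm (proj₂ bound))
      where
      open Decomposition (clouds α)
      form : ⟨ adjacency Z $ᵥ α , α ⟩ ≈ ⟪ (λ p → A x p + A y p) , (λ p → x p + y p) ⟫
      form = trans (zigzag-form α) (⟪⟫-cong (λ p → Bb≈x+y (rot G₁ p)) Bb≈x+y)
      norm : f * (⟪ x , x ⟫ + ⟪ z , z ⟫) ≈ f * ⟨ α , α ⟩
      norm = *-congˡ (sym (trans (clouds-isometry α α) pythagoras))
      bound = reflectionForm-bound (pairSum N₁ D₁) (rot-isReflection G₁) eq x⊥y
        (Ax,x bound₁ (trans (sym (sum-combine {N₁} {D₁} α)) ∑α≈0)) (⟪⟫-nonNeg z) (y≤ bound₂)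

    zigzag-spectral : ∀ {l₁ l₂} → 0# ≤ l₁ → 0# ≤ l₂ → l₂ ≤ 1# →
      IsSpectralGraph N₁ D₁ l₁ G₁ → IsSpectralGraph D₁ D₂ l₂ G₂ →
      IsSpectralGraph (N₁ *ℕ D₁) (D₂ *ℕ D₂) (zigzagBound l₁ l₂) Z
    zigzag-spectral {l₁} {l₂} 0≤l₁ 0≤l₂ l₂≤1 h₁ h₂ = normBound⇒spectral Z f≥0
      (formBound⇒normBound Z f≥0 (zigzag-formBound eq
        (normBound⇒formBound G₁ 0≤l₁ (spectral⇒normBound G₁ 0≤l₁ h₁))
        (spectral⇒normBound G₂ 0≤l₂ h₂)))
      where
      eq : BoundEquation l₁ (l₂ ²) (zigzagBound l₁ l₂)
      eq = zigzagBound-equation 0≤l₁ 0≤l₂ l₂≤1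
      f≥0 : 0# ≤ zigzagBound l₁ l₂
      f≥0 = ≤-trans (BoundEquation.L≥0 eq) (BoundEquation.L≤f eq)

theorem4p3 : (ℝ : RealNumbers) → let open Spectral ℝ in
  (N₁ D₁ D₂ : ℕ) .{{_ : NonZero N₁}} .{{_ : NonZero D₁}} .{{_ : NonZero D₂}} →
  (λ₁ λ₂ : Carrier) → 0# ≤ λ₁ → λ₁ ≤ 1# → 0# ≤ λ₂ → λ₂ ≤ 1# →
  (G₁ : Graph (Fin N₁) (Fin D₁)) (G₂ : Graph (Fin D₁) (Fin D₂)) →
  IsSpectralGraph N₁ D₁ λ₁ G₁ →
  IsSpectralGraph D₁ D₂ λ₂ G₂ →
  IsSpectralGraph (N₁ *ℕ D₁) (D₂ *ℕ D₂) (zigzagBound λ₁ λ₂)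
    (relabel *↔× *↔× (zigzag G₁ G₂))
theorem4p3 ℝ N₁ D₁ D₂ λ₁ λ₂ 0≤λ₁ _ 0≤λ₂ λ₂≤1 G₁ G₂ =
  ZigzagOperator.zigzag-spectral ℝ G₁ G₂ 0≤λ₁ 0≤λ₂ λ₂≤1
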